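{- Let $n\ge1$, $l\in\{0,\dots,2n\}$, $k\ge0$, let $t_1,\dots,t_k$ be positive even integers and $p_0,\dots,p_k\ge0$ integers, with $t=\sum_{j=0}^kp_j+\sum_{j=1}^kt_j\in\{1,\dots,n\}$, $t\le\min\{l,2n-l\}$ and $l-t$ even. Let $$\mathbf a=X^{(0)}\mathbf A_1X^{(1)}\cdots X^{(k-1)}\mathbf A_kX^{(k)}\in SpT_{2n}(\varpi_t),$$ where $X^{(i)}=(x^{(i)}_1)\cdots(x^{(i)}_{p_i})$ for $0\le i\le k$, $\ \mathbf s(X^{(0)}X^{(1)}\cdots X^{(k)})\cap\mathbf a=\emptyset$, and the $\mathbf A_i=(a_i,a_i+1,\dots,a_i+t_i-1)$, $a_i$ odd, $1\le i\le k$, are the maximal nonempty intervals in $\mathbf a$ with $\mathbf s(\mathbf A_i)=\mathbf A_i$, satisfying $$a_i\ge2t^{(i-1)}+t_i+1,\qquad t^{(i)}:=\sum_{j=1}^{i}t_j+\sum_{j=0}^{i}p_j\quad(\text{so }t^{(0)}=p_0,\ t^{(k)}=t).$$ Use the conventions $t^{(-1)}=t_0=0$, $x^{(0)}_0=0$, and $x^{(i)}_0=a_i+t_i-1$ for $1\le i\le k$. For $i=0,1,\dots,k$ define recursively numbers $\tilde l_{i+1}$ and $l_{t^{(i-1)}+t_i+j+1}$, $0\le j\le p_i$, as follows. Put $S_i=\sum_{r=0}^{i-1}\ \sum_{m=t^{(r-1)}+t_r+1}^{t^{(r)}+1}l_m$ (so $S_0=0$) and $$\tilde l_{i+1}=\min\Big(\big\{a_j-2t^{(j-1)}-t_j-1-S_i:\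 i+1\le j\le k\big\}\cup\big\{l-t-S_i\big\}\Big)$$ (in particular $\tilde l_{k+1}=l-t-S_k$). If $p_i\ge1$, put $$l_{t^{(i-1)}+t_i+1}=\begin{cases}\min\{x^{(i)}_1-x^{(i)}_0-2,\ \tilde l_{i+1}\},&x^{(i)}_1\text{ even}\\ \min\{x^{(i)}_1-x^{(i)}_0-1,\ \tilde l_{i+1}\},&x^{(i)}_1\text{ odd;}\end{cases}$$ for $1\le j<p_i$, with $R_{i,j}=\tilde l_{i+1}-\sum_{m=1}^{j}l_{t^{(i-1)}+t_i+m}$, $$l_{t^{(i-1)}+t_i+j+1}=\begin{cases}\min\{x^{(i)}_{j+1}-x^{(i)}_j-2,\ R_{i,j}\},&x^{(i)}_j,x^{(i)}_{j+1}\text{ both even or both odd}\\ \min\{x^{(i)}_{j+1}-x^{(i)}_j-1,\ R_{i,j}\},&x^{(i)}_j\text{ even},\ x^{(i)}_{j+1}\text{ odd}\\ \min\{x^{(i)}_{j+1}-x^{(i)}_j-3,\ R_{i,j}\},&x^{(i)}_j\text{ odd},\ x^{(i)}_{j+1}\text{ even;}\end{cases}$$ and finally (for any $p_i\ge0$) $$l_{t^{(i)}+1}=\tilde l_{i+1}-\sum_{m=1}^{p_i}l_{t^{(i-1)}+t_i+m}.$$ Then all the numbers $\tilde l_{i+1}$ and $l_{t^{(i-1)}+t_i+j+1}$ ($0\le i\le k$, $0\le j\le p_i$) are nonnegative and even. Put, for $0\le i\le k$, $$T^{(i)}_0=(x^{(i)}_0+1,\ x^{(i)}_0+2,\dots,x^{(i)}_0+l_{t^{(i-1)}+t_i+1}),$$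 and for $1\le j\le p_i$ $$T^{(i)}_j=\begin{cases}(x^{(i)}_j+1,\dots,x^{(i)}_j+l_{t^{(i-1)}+t_i+j+1}),&x^{(i)}_j\text{ even}\\ (x^{(i)}_j+1+1,\ x^{(i)}_j+1+2,\dots,x^{(i)}_j+1+l_{t^{(i-1)}+t_i+j+1}),&x^{(i)}_j\text{ odd}\end{cases}$$ (empty if the corresponding $l$ is $0$). Then the concatenation $$T=T^{(0)}_0(x^{(0)}_1)T^{(0)}_1\cdots(x^{(0)}_{p_0})T^{(0)}_{p_0}\,\mathbf A_1\,T^{(1)}_0(x^{(1)}_1)T^{(1)}_1\cdots(x^{(1)}_{p_1})T^{(1)}_{p_1}\cdots\mathbf A_k\,T^{(k)}_0(x^{(k)}_1)T^{(k)}_1\cdots(x^{(k)}_{p_k})T^{(k)}_{p_k}$$ is an element of $SST_{2n}(\varpi_l)$ with $\mathrm{red}(T)=\mathbf a$; that is, $T=\mathrm{red}_t^{ -1}(\mathbf a)$ is the unique preimage of $\mathbf a$ in $SST_{2n}(\varpi_l)$ under the reduction map.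
   Context: $SST_{2n}(\varpi_l)$ is the set of columns of length $l$ on the alphabet $\{1,\dots,2n\}$, i.e. strictly increasing sequences $(b_1<\dots<b_l)$ with entries in $\{1,\dots,2n\}$, often identified with the set of entries or with a word. $SpT_{2n}(\varpi_t)\subseteq SST_{2n}(\varpi_t)$ is the subset of symplectic columns: $b_k\ge2k-1$ for all $k$. The parity involution is $\mathbf s(x)=x+1$ for $x$ odd, $\mathbf s(x)=x-1$ for $x$ even, applied elementwise to sets and words. "Maximal nonempty interval with $\mathbf s(\mathbf A)=\mathbf A$" means maximal for inclusion among nonempty sets of consecutive integers $I\subseteq\mathbf a$ with $\mathbf s(I)=I$. For a column $\mathbf b=(b_1,\dots,b_l)$ the removal subword $\mathrm{rem}(\mathbf b)$ is defined recursively: $\mathrm{rem}(\mathbf b)=\emptyset$ if $l\le1$; if $l\ge2$, $b_l$ is even, $b_{l-1}=b_l-1$ and $b_l<2l-|\mathrm{rem}(b_1,\dots,b_{l-2})|-1$, then $\mathrm{rem}(\mathbf b)=\mathrm{rem}(b_1,\dots,b_{l-2})\cup\{b_{l-1},b_l\}$; otherwise $\mathrm{rem}(\mathbf b)=\mathrm{rem}(b_1,\dots,b_{l-1})$. The reduction of $\mathbf b$ is $\mathrm{red}(\mathbf b)=\mathbf b\setminus\mathrm{rem}(\mathbf b)$. It is known (Watanabe) that $\mathrm{red}$ is injective on $SST_{2n}(\varpi_l)$ and takes values in $\bigsqcup_t SpT_{2n}(\varpi_t)$ over $0\le t\le\min\{l,2n-l\}$, $l-t$ even; $\mathrm{red}_t^{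 -1}(\mathbf a)=T$ means $T\in SST_{2n}(\varpi_l)$ and $\mathrm{red}(T)=\mathbf a$. -}

module Defs where

open import Data.Bool using (Bool; true; false; if_then_else_; _∧_)
open import Data.Integer as ℤ using (ℤ; +_; 0ℤ; ∣_∣)
open import Data.List using (List; []; _∷_; _++_; length; lookup; map; reverse; filter; foldr; upTo; applyUpTo)
open import Data.List.Relation.Binary.BagAndSetEquality using (_∼[_]_; set)
open import Data.List.Relation.Binary.Subset.Propositional using (_⊆_)
open import Data.List.Relation.Unary.All using (All)
open import Data.List.Relation.Unary.Linked using (Linked)
open import Data.Fin using (Fin; toℕ)
open import Data.Nat using (ℕ; zero; suc; _+_; _*_; _∸_; _≤_; _<_; _≟_; _<?_)
open import Data.List.Membership.DecPropositional _≟_ using (_∈?_)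
open import Data.Nat.Divisibility using (_∣?_)
open import Data.Product using (_×_)
open import Relation.Binary.PropositionalEquality using (_≡_)
open import Relation.Nullary.Decidable using (does; ¬?)

even? : ℕ → Bool
even? x = does (2 ∣? x)

-- The parity involution on positive integers; the value s 0 ≡ 0 is never
-- relevant, since column entries are positive.
s : ℕ → ℕ
s x = if even? x then x ∸ 1 else suc x

------------------------------------------------------------------------
-- Columns

record IsSST (n l : ℕ) (b : List ℕ) : Set where
  field
    length≡    : length b ≡ l
    increasing : Linked _<_ b
    entries    : All (λ x → 1 ≤ x × x ≤ 2 * n) b

-- `symplectic` is b_k ≥ 2k - 1 for the 1-based position k = 1 + toℕ i.
record IsSpT (n l : ℕ) (b : List ℕ) : Set where
  field
    isSST      : IsSST n l b
    symplectic : ∀ (i : Fin (length b)) → 2 * toℕ i + 1 ≤ lookup b i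

-- The removal subword, on reversed columns: for b = (b_1, …, b_l) with l ≥ 2
-- the argument is b_l ∷ b_{l-1} ∷ b_{l-2} ∷ …  The inequality
-- b_l < 2l - |rem (b_1, …, b_{l-2})| - 1 is written without subtraction.
remʳ : List ℕ → List ℕ
remʳ []           = []
remʳ (_ ∷ [])     = []
remʳ (y ∷ x ∷ zs) =
  if even? y
     ∧ does (suc x ≟ y)
     ∧ does (y + length (remʳ zs) + 1 <? 2 * (2 + length zs))
  then y ∷ x ∷ remʳ zs
  else remʳ (x ∷ zs)

rem : List ℕ → List ℕ
rem b = reverse (remʳ (reverse b))

red : List ℕ → List ℕ
red b = filter (λ z → ¬? (z ∈? rem b)) b

------------------------------------------------------------------------
-- Intervals

-- (c, c + 1, …, c + m - 1)
interval : ℕ → ℕ → List ℕ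
interval c m = applyUpTo (λ d → c + d) m

record StableInterval (a : List ℕ) (c m : ℕ) : Set where
  field
    nonempty : 1 ≤ m
    inside   : interval c m ⊆ a
    stable   : map s (interval c m) ∼[ set ] interval c m

record MaximalStableInterval (a : List ℕ) (c m : ℕ) : Set where
  field
    isStable : StableInterval a c m
    maximal  : ∀ c′ m′ → StableInterval a c′ m′ →
               interval c m ⊆ interval c′ m′ → interval c′ m′ ⊆ interval c m

------------------------------------------------------------------------
-- The construction

-- Families are functions on ℕ of which only the following values are used:
--   t i = t_i and α i = a_i  for 1 ≤ i ≤ k,
--   p i = p_i                for 0 ≤ i ≤ k,
--   x i j = x^{(i)}_j        for 0 ≤ i ≤ k and 1 ≤ j ≤ p_i.
module Construction (k : ℕ) (t p α : ℕ → ℕ) (x : ℕ → ℕ → ℕ) where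

  -- t^{(i)}
  t⁽_⁾ : ℕ → ℕ
  t⁽ zero ⁾  = p 0
  t⁽ suc i ⁾ = t⁽ i ⁾ + t (suc i) + p (suc i)

  X : ℕ → List ℕ
  X i = applyUpTo (λ j → x i (suc j)) (p i)

  A : ℕ → List ℕ
  A i = interval (α i) (t i)

  -- X^{(0)} A_1 X^{(1)} ⋯ A_i X^{(i)}
  a-upTo : ℕ → List ℕ
  a-upTo zero    = X 0
  a-upTo (suc i) = a-upTo i ++ A (suc i) ++ X (suc i)

  a : List ℕ
  a = a-upTo k

  -- x^{(i)}_j including the conventional values at j = 0
  x̂ : ℕ → ℕ → ℕ
  x̂ zero    zero    = 0
  x̂ (suc i) zero    = α (suc i) + t (suc i) ∸ 1
  x̂ i       (suc j) = x i (suc j)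

  -- The constant subtracted from x^{(i)}_{j+1} - x^{(i)}_j, as a function of
  -- the evenness of x^{(i)}_j and x^{(i)}_{j+1}
  offset : Bool → Bool → ℕ
  offset true  true  = 2
  offset false false = 2
  offset true  false = 1
  offset false true  = 3

  offset₀ : Bool → ℕ
  offset₀ true  = 2
  offset₀ false = 1

  gap : ℕ → ℕ → ℤ
  gap i zero    = + x i 1 ℤ.- + x̂ i 0 ℤ.- + offset₀ (even? (x i 1))
  gap i (suc j) = + x i (2 + j) ℤ.- + x i (suc j)
                  ℤ.- + offset (even? (x i (suc j))) (even? (x i (2 + j)))

  -- a_{j+1} - 2 t^{(j)} - t_{j+1} - 1
  slack : ℕ → ℤ
  slack j = + α (suc j) ℤ.- + (2 * t⁽ j ⁾) ℤ.- + t (suc j) ℤ.- + 1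

  -- The minimum of slack j - S for i ≤ j < k and of l - t - S
  minSlack : (l i : ℕ) → ℤ → ℤ
  minSlack l i S = foldr ℤ._⊓_ (+ l ℤ.- + t⁽ k ⁾ ℤ.- S)
                     (map (λ d → slack (i + d) ℤ.- S) (upTo (k ∸ i)))

  module _ (l : ℕ) where

    -- The pairs (i , j) with 0 ≤ i ≤ k and 0 ≤ j ≤ p_i replace the indices
    -- m = t^{(i-1)} + t_i + j + 1, which they parametrise bijectively; for
    -- fixed i these are the m from t^{(i-1)} + t_i + 1 to t^{(i)} + 1.
    --   ℓ i j      = l_{t^{(i-1)} + t_i + j + 1}
    --   ∑ℓ i j     = ℓ i 0 + ⋯ + ℓ i (j - 1)
    --   l̃₊₁ i      = l̃_{i+1}
    mutual
      S : ℕ → ℤ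
      S zero    = 0ℤ
      S (suc i) = S i ℤ.+ ∑ℓ i (suc (p i))

      l̃₊₁ : ℕ → ℤ
      l̃₊₁ i = minSlack l i (S i)

      R : ℕ → ℕ → ℤ
      R i j = l̃₊₁ i ℤ.- ∑ℓ i j

      ℓ : ℕ → ℕ → ℤ
      ℓ i j = if does (j <? p i) then gap i j ℤ.⊓ R i j else R i j

      ∑ℓ : ℕ → ℕ → ℤ
      ∑ℓ i zero    = 0ℤ
      ∑ℓ i (suc j) = ∑ℓ i j ℤ.+ ℓ i j

    -- T^{(i)}_j; the absolute value only serves to read the nonnegative
    -- integer ℓ i j as a natural number.
    Tseg : ℕ → ℕ → List ℕ
    Tseg i zero    = interval (x̂ i 0 + 1) ∣ ℓ i 0 ∣
    Tseg i (suc j) = interval (x i (suc j) + (if even? (x i (suc j)) then 1 else 2))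
                              ∣ ℓ i (suc j) ∣

    -- T^{(i)}_0 (x^{(i)}_1) T^{(i)}_1 ⋯ (x^{(i)}_j) T^{(i)}_j
    Tblock : ℕ → ℕ → List ℕ
    Tblock i zero    = Tseg i 0
    Tblock i (suc j) = Tblock i j ++ x i (suc j) ∷ Tseg i (suc j)

    T-upTo : ℕ → List ℕ
    T-upTo zero    = Tblock 0 (p 0)
    T-upTo (suc i) = T-upTo i ++ A (suc i) ++ Tblock (suc i) (p (suc i))

    T : List ℕ
    T = T-upTo k

{-# OPTIONS --safe #-}

-- Read a column pair by pair, {1, 2}, {3, 4}, …  A full pair is removed by the
-- reduction exactly when every earlier empty pair is already matched with an
-- earlier kept full pair, so red is a stack machine: empty pairs are pushed, a
-- full pair pops, and a full pair meeting the empty stack is emptied.  Hence a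
-- preimage of a arises by filling empty pairs of a, and its length determines
-- which.  Put M_i = ½ min({a_j - 2t^{(j-1)} - t_j - 1 : j > i} ∪ {l - t}) and
-- M_{-1} = 0.  The numbers in the theorem say that in X^{(i)} the first
-- M_i - M_{i-1} empty pairs are filled.  Since M_{i-1} is the minimum of M_i and
-- the number of empty pairs of a still unmatched after A_i, either the stack is
-- empty after A_i or nothing is filled in X^{(i)}; so filled pairs always meet
-- the empty stack, while every A_i still finds enough empty pairs to match.

module Submission where

open import Defs
open import Data.Bool using (true; false; if_then_else_)
open import Data.Empty using (⊥-elim)
open import Data.Integer as ℤ using (ℤ; 0ℤ; +_)
open import Data.Integer.Divisibility as ℤ using ()
import Data.Integer.Properties as ℤ
open import Data.List using (List; []; _∷_; _++_; length; reverse; filter; foldr; replicate; applyUpTo; _ʳ++_)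
open import Data.List.Membership.Propositional using (_∈_; _∉_)
open import Data.List.Membership.Propositional.Properties using (∈-++⁺ˡ; ∈-++⁺ʳ; ∈-applyUpTo⁺)
open import Data.List.Properties
  using (++-assoc; ++-identityʳ; length-++; length-replicate; map-applyUpTo; applyUpTo-∷ʳ;
         reverse-involutive; filter-accept; filter-reject; ∷-injectiveˡ; ∷-injectiveʳ)
open import Data.List.Relation.Unary.All as All using (All; []; _∷_)
import Data.List.Relation.Unary.All.Properties as All
open import Data.List.Relation.Unary.AllPairs using (AllPairs; []; _∷_)
open import Data.List.Relation.Unary.Any using (here; there)
open import Data.List.Relation.Unary.Linked as Linked using (Linked; [-]; _∷_)
open import Data.List.Relation.Unary.Linked.Properties using (Linked⇒AllPairs)
open import Data.Nat
  using (ℕ; zero; suc; _+_; _*_; _∸_; _/_; _⊓_; _⊔_; _≤_; _<_; z≤n; s≤s; _≟_; _<?_; _≤′_; ≤′-refl; ≤′-step)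
open import Data.List.Membership.DecPropositional _≟_ using (_∈?_)
open import Data.Nat.Divisibility using (_∣_; _∣?_; divides; ∣-refl; ∣m∣n⇒∣m+n; ∣m+n∣m⇒∣n; ∣⇒≤; m∣m*n)
open import Data.Nat.DivMod using (m*[n/m]≡n)
open import Data.Nat.Properties
open import Data.Nat.Tactic.RingSolver using (solve-∀)
open import Data.Product using (_×_; _,_; proj₁; proj₂; ∃-syntax)
open import Data.Sum using (_⊎_; inj₁; inj₂)
open import Function using (_∘_; _⇔_; Equivalence; mk⇔)
open import Relation.Binary.PropositionalEquality
  using (_≡_; _≢_; refl; sym; trans; cong; cong₂; subst)
open import Relation.Nullary using (¬_; yes; no; contradiction)
open import Relation.Nullary.Decidable using (¬?; dec-true; dec-false)

-- Parity

even⇒even+2 : ∀ {o} → 2 ∣ o → 2 ∣ 2 + o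
even⇒even+2 = ∣m∣n⇒∣m+n ∣-refl

even⇒suc-odd : ∀ {o} → 2 ∣ o → ¬ 2 ∣ suc o
even⇒suc-odd 2∣o 2∣1+o with ∣⇒≤ (∣m+n∣m⇒∣n (subst (2 ∣_) (+-comm 1 _) 2∣1+o) 2∣o)
... | s≤s ()

even?-even : ∀ {x} → 2 ∣ x → even? x ≡ true
even?-even {x} = dec-true (2 ∣? x)

even?-odd : ∀ {x} → ¬ 2 ∣ x → even? x ≡ false
even?-odd {x} = dec-false (2 ∣? x)

-- Columns as words

-- The part of a column inside a pair {2c - 1, 2c}.
data Pair : Set where
  none low high both : Pair

Word : Set
Word = List Pair

-- The entries of a word whose first pair is {o + 1, o + 2}, with o even.
column : ℕ → Word → List ℕ
column o []         = []
column o (none ∷ w) = column (2 + o) w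
column o (low  ∷ w) = suc o ∷ column (2 + o) w
column o (high ∷ w) = 2 + o ∷ column (2 + o) w
column o (both ∷ w) = suc o ∷ 2 + o ∷ column (2 + o) w

size : Word → ℕ
size []         = 0
size (none ∷ w) = size w
size (low  ∷ w) = suc (size w)
size (high ∷ w) = suc (size w)
size (both ∷ w) = 2 + size w

-- Reduction started with d unmatched empty pairs: a full pair is kept when it
-- can be matched with an earlier empty one, and emptied otherwise.
reduce : ℕ → Word → Word
reduce d       []         = []
reduce d       (none ∷ w) = none ∷ reduce (suc d) w
reduce d       (low  ∷ w) = low ∷ reduce d w
reduce d       (high ∷ w) = high ∷ reduce d w
reduce zero    (both ∷ w) = none ∷ reduce zero w
reduce (suc d) (both ∷ w) = both ∷ reduce d w

-- The complement of `reduce d w` in `w`. The recursion for `rem` produces this word, and `red` then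
-- deletes its entries.
removed : ℕ → Word → Word
removed d       []         = []
removed d       (none ∷ w) = none ∷ removed (suc d) w
removed d       (low  ∷ w) = none ∷ removed d w
removed d       (high ∷ w) = none ∷ removed d w
removed zero    (both ∷ w) = both ∷ removed zero w
removed (suc d) (both ∷ w) = none ∷ removed d w

length-column : ∀ o w → length (column o w) ≡ size w
length-column o []         = refl
length-column o (none ∷ w) = length-column (2 + o) w
length-column o (low  ∷ w) = cong suc (length-column (2 + o) w)
length-column o (high ∷ w) = cong suc (length-column (2 + o) w)
length-column o (both ∷ w) = cong (suc ∘ suc) (length-column (2 + o) w)

length-reduce : ∀ d w → length (reduce d w) ≡ length w
length-reduce d       []         = refl
length-reduce d       (none ∷ w) = cong suc (length-reduce (suc d) w)
length-reduce d       (low  ∷ w) = cong suc (length-reduce d w)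
length-reduce d       (high ∷ w) = cong suc (length-reduce d w)
length-reduce zero    (both ∷ w) = cong suc (length-reduce zero w)
length-reduce (suc d) (both ∷ w) = cong suc (length-reduce d w)

column-> : ∀ o w → All (o <_) (column o w)
column-> o w = go o w
  where
  weaken : ∀ {o xs} → All (2 + o <_) xs → All (o <_) xs
  weaken = All.map (λ p → <-trans (<-trans (n<1+n _) (n<1+n _)) p)
  go : ∀ o w → All (o <_) (column o w)
  go o []         = []
  go o (none ∷ w) = weaken (go (2 + o) w)
  go o (low  ∷ w) = ≤-refl ∷ weaken (go (2 + o) w)
  go o (high ∷ w) = n≤1+n _ ∷ weaken (go (2 + o) w)
  go o (both ∷ w) = ≤-refl ∷ n≤1+n _ ∷ weaken (go (2 + o) w)

column-≤ : ∀ o w → All (_≤ o + 2 * length w) (column o w)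
column-≤ o w = go o w
  where
  shift : ∀ o m → 2 + o + 2 * m ≡ o + 2 * suc m
  shift = solve-∀
  weaken : ∀ {o m xs} → All (_≤ 2 + o + 2 * m) xs → All (_≤ o + 2 * suc m) xs
  weaken {o} {m} = All.map (λ p → ≤-trans p (≤-reflexive (shift o m)))
  second : ∀ o m → 2 + o ≤ o + 2 * suc m
  second o m = ≤-trans (m≤m+n (2 + o) (2 * m)) (≤-reflexive (shift o m))
  first : ∀ o m → suc o ≤ o + 2 * suc m
  first o m = ≤-trans (n≤1+n _) (second o m)
  go : ∀ o w → All (_≤ o + 2 * length w) (column o w)
  go o []         = []
  go o (none ∷ w) = weaken {o} (go (2 + o) w)
  go o (low  ∷ w) = first o _ ∷ weaken {o} (go (2 + o) w)
  go o (high ∷ w) = second o _ ∷ weaken {o} (go (2 + o) w)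
  go o (both ∷ w) = first o _ ∷ second o _ ∷ weaken {o} (go (2 + o) w)

lower-head : ∀ {m n xs} → m ≤ n → Linked _<_ (n ∷ xs) → Linked _<_ (m ∷ xs)
lower-head m≤n [-]         = [-]
lower-head m≤n (n<x ∷ lnk) = ≤-<-trans m≤n n<x ∷ lnk

-- The offset heads the list because `none` pairs contribute no entry: the lower bound has to be
-- carried across them.
column-increasing : ∀ o w → Linked _<_ (o ∷ column o w)
column-increasing o []         = [-]
column-increasing o (none ∷ w) = lower-head (m≤n+m o 2) (column-increasing (2 + o) w)
column-increasing o (low  ∷ w) = ≤-refl ∷ lower-head (n≤1+n _) (column-increasing (2 + o) w)
column-increasing o (high ∷ w) = n≤1+n _ ∷ column-increasing (2 + o) w
column-increasing o (both ∷ w) = ≤-refl ∷ ≤-refl ∷ column-increasing (2 + o) w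

column-++ : ∀ o u v → column o (u ++ v) ≡ column o u ++ column (o + 2 * length u) v
column-++ o u v = go o u
  where
  shift : ∀ o m → 2 + o + 2 * m ≡ o + 2 * suc m
  shift = solve-∀
  at : ∀ o u → column (2 + o) (u ++ v) ≡ column (2 + o) u ++ column (2 + o + 2 * length u) v →
       column (2 + o) (u ++ v) ≡ column (2 + o) u ++ column (o + 2 * suc (length u)) v
  at o u eq = trans eq (cong (λ e → column (2 + o) u ++ column e v) (shift o (length u)))
  go : ∀ o u → column o (u ++ v) ≡ column o u ++ column (o + 2 * length u) v
  go o []         = cong (λ e → column e v) (sym (+-identityʳ o))
  go o (none ∷ u) = at o u (go (2 + o) u)
  go o (low  ∷ u) = cong (suc o ∷_) (at o u (go (2 + o) u))
  go o (high ∷ u) = cong (2 + o ∷_) (at o u (go (2 + o) u))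
  go o (both ∷ u) = cong (λ xs → suc o ∷ 2 + o ∷ xs) (at o u (go (2 + o) u))

column-head-absurd : ∀ {o x xs w} → x ≤ o → column o w ≢ x ∷ xs
column-head-absurd {o} {w = w} x≤o eq with column o w | column-> o w
column-head-absurd x≤o refl | _ | o<x ∷ _ = <⇒≱ o<x x≤o

-- Equal lengths are needed because trailing `none` pairs leave no trace. Where two words first
-- differ, one column has an entry at most `2 + o` that the other lacks, all later entries being
-- larger.
column-injective : ∀ o u v → length u ≡ length v → column o u ≡ column o v → u ≡ v
column-injective o []         []         len eq = refl
column-injective o (none ∷ u) (none ∷ v) len eq =
  cong (none ∷_) (column-injective (2 + o) u v (suc-injective len) eq)
column-injective o (low  ∷ u) (low  ∷ v) len eq =
  cong (low ∷_) (column-injective (2 + o) u v (suc-injective len) (∷-injectiveʳ eq))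
column-injective o (high ∷ u) (high ∷ v) len eq =
  cong (high ∷_) (column-injective (2 + o) u v (suc-injective len) (∷-injectiveʳ eq))
column-injective o (both ∷ u) (both ∷ v) len eq =
  cong (both ∷_) (column-injective (2 + o) u v (suc-injective len) (∷-injectiveʳ (∷-injectiveʳ eq)))
column-injective o (none ∷ u) (low  ∷ v) len eq = ⊥-elim (column-head-absurd {w = u} (n≤1+n _) eq)
column-injective o (none ∷ u) (high ∷ v) len eq = ⊥-elim (column-head-absurd {w = u} ≤-refl eq)
column-injective o (none ∷ u) (both ∷ v) len eq = ⊥-elim (column-head-absurd {w = u} (n≤1+n _) eq)
column-injective o (low  ∷ u) (none ∷ v) len eq = ⊥-elim (column-head-absurd {w = v} (n≤1+n _) (sym eq))
column-injective o (high ∷ u) (none ∷ v) len eq = ⊥-elim (column-head-absurd {w = v} ≤-refl (sym eq))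
column-injective o (both ∷ u) (none ∷ v) len eq = ⊥-elim (column-head-absurd {w = v} (n≤1+n _) (sym eq))
column-injective o (low  ∷ u) (high ∷ v) len eq = ⊥-elim (1+n≢n (sym (∷-injectiveˡ eq)))
column-injective o (high ∷ u) (low  ∷ v) len eq = ⊥-elim (1+n≢n (∷-injectiveˡ eq))
column-injective o (both ∷ u) (high ∷ v) len eq = ⊥-elim (1+n≢n (sym (∷-injectiveˡ eq)))
column-injective o (high ∷ u) (both ∷ v) len eq = ⊥-elim (1+n≢n (∷-injectiveˡ eq))
column-injective o (low  ∷ u) (both ∷ v) len eq = ⊥-elim (column-head-absurd {w = u} ≤-refl (∷-injectiveʳ eq))
column-injective o (both ∷ u) (low  ∷ v) len eq = ⊥-elim (column-head-absurd {w = v} ≤-refl (∷-injectiveʳ (sym eq)))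

-- A greedy parse: `first` looks for `suc o` and, failing that, for `2 + o`; `second` looks for
-- `2 + o` once `suc o` has been found.
column-surjective : ∀ n o b → Linked _<_ (o ∷ b) → All (_≤ o + 2 * n) b →
                    ∃[ w ] length w ≡ n × column o w ≡ b
column-surjective zero    o []       _ _ = [] , refl , refl
column-surjective zero    o (x ∷ b)  (o<x ∷ _) (x≤o ∷ _) =
  contradiction (≤-trans x≤o (≤-reflexive (+-identityʳ o))) (<⇒≱ o<x)
column-surjective (suc n) o b        lnk bnd = first b lnk (All.map (λ p → ≤-trans p (≤-reflexive (shift o n))) bnd)
  where
  shift : ∀ o m → o + 2 * suc m ≡ 2 + o + 2 * m
  shift = solve-∀
  cons : ∀ P ys {b} → (∀ w → column o (P ∷ w) ≡ ys ++ column (2 + o) w) →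
         Linked _<_ (2 + o ∷ b) → All (_≤ 2 + o + 2 * n) b →
         ∃[ w ] length w ≡ suc n × column o w ≡ ys ++ b
  cons P ys eq lnk bnd with column-surjective n (2 + o) _ lnk bnd
  ... | w , len , refl = P ∷ w , cong suc len , eq w
  second : ∀ b → Linked _<_ (suc o ∷ b) → All (_≤ 2 + o + 2 * n) b →
           ∃[ w ] length w ≡ suc n × column o w ≡ suc o ∷ b
  second []      lnk bnd = cons low (suc o ∷ []) (λ _ → refl) [-] bnd
  second (y ∷ b) (o<y ∷ lnk) (y≤ ∷ bnd) with 2 + o ≟ y
  ... | yes refl = cons both (suc o ∷ 2 + o ∷ []) (λ _ → refl) lnk bnd
  ... | no  o≢y  = cons low (suc o ∷ []) (λ _ → refl) (≤∧≢⇒< o<y o≢y ∷ lnk) (y≤ ∷ bnd)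
  first : ∀ b → Linked _<_ (o ∷ b) → All (_≤ 2 + o + 2 * n) b →
          ∃[ w ] length w ≡ suc n × column o w ≡ b
  first []      lnk bnd = cons none [] (λ _ → refl) [-] bnd
  first (x ∷ b) (o<x ∷ lnk) (x≤ ∷ bnd) with suc o ≟ x | 2 + o ≟ x
  ... | yes refl | _        = second b lnk bnd
  ... | no  _    | yes refl = cons high (2 + o ∷ []) (λ _ → refl) lnk bnd
  ... | no  o≢x  | no o′≢x  = cons none [] (λ _ → refl) (≤∧≢⇒< (≤∧≢⇒< o<x o≢x) o′≢x ∷ lnk) (x≤ ∷ bnd)

-- The reduction map on words

remʳ-odd : ∀ {y} zs → ¬ 2 ∣ y → remʳ (y ∷ zs) ≡ remʳ zs
remʳ-odd []       odd = refl
remʳ-odd {y} (x ∷ zs) odd rewrite even?-odd odd = refl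

remʳ-gap : ∀ {y} zs → All (λ x → suc x ≢ y) zs → remʳ (y ∷ zs) ≡ remʳ zs
remʳ-gap []       _ = refl
remʳ-gap {y} (x ∷ zs) (x≢y ∷ _)
  rewrite dec-false (suc x ≟ y) x≢y with even? y
... | true  = refl
... | false = refl

remʳ-remove : ∀ {o} zs → 2 ∣ o → 2 + o + length (remʳ zs) + 1 < 2 * (2 + length zs) →
              remʳ (2 + o ∷ suc o ∷ zs) ≡ 2 + o ∷ suc o ∷ remʳ zs
remʳ-remove {o} zs 2∣o small
  rewrite even?-even (even⇒even+2 2∣o)
        | dec-true (2 + o ≟ 2 + o) refl
        | dec-true (2 + o + length (remʳ zs) + 1 <? 2 * (2 + length zs)) small = refl

remʳ-keep : ∀ {o} zs → 2 ∣ o → ¬ 2 + o + length (remʳ zs) + 1 < 2 * (2 + length zs) →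
            remʳ (2 + o ∷ suc o ∷ zs) ≡ remʳ zs
-- Once the even entry is passed over, its odd partner heads the list and fails the evenness test.
remʳ-keep {o} zs 2∣o large
  rewrite even?-even (even⇒even+2 2∣o)
        | dec-true (2 + o ≟ 2 + o) refl
        | dec-false (2 + o + length (remʳ zs) + 1 <? 2 * (2 + length zs)) large = remʳ-odd zs (even⇒suc-odd 2∣o)

-- With c pairs read, κ entries kept and 2ρ removed, d = c - κ - ρ; the balance
-- equation below says this for o = 2c, |acc| = κ + 2ρ and |remʳ acc| = 2ρ.
remʳ-column : ∀ w {d o} acc → 2 ∣ o → All (_≤ o) acc →
              2 * d + 2 * length acc ≡ o + length (remʳ acc) →
              remʳ (column o w ʳ++ acc) ≡ column o (removed d w) ʳ++ remʳ acc
remʳ-column []         acc 2∣o bnd eq = refl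
remʳ-column (none ∷ w) {d} acc 2∣o bnd eq =
  remʳ-column w acc (even⇒even+2 2∣o) (All.map (λ p → ≤-trans p (m≤n+m _ 2)) bnd)
    (trans (step d (length acc)) (cong (suc ∘ suc) eq))
  where
  step : ∀ d m → 2 * suc d + 2 * m ≡ 2 + (2 * d + 2 * m)
  step = solve-∀
remʳ-column (low ∷ w) {d} {o} acc 2∣o bnd eq =
  trans (remʳ-column w (suc o ∷ acc) (even⇒even+2 2∣o)
          (n≤1+n _ ∷ All.map (λ p → ≤-trans p (m≤n+m _ 2)) bnd)
          (trans (step d (length acc)) (cong (suc ∘ suc) (trans eq (cong (λ r → o + length r) (sym skip))))))
        (cong (column (2 + o) (removed d w) ʳ++_) skip)
  where
  skip = remʳ-odd acc (even⇒suc-odd 2∣o)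
  step : ∀ d m → 2 * d + 2 * suc m ≡ 2 + (2 * d + 2 * m)
  step = solve-∀
remʳ-column (high ∷ w) {d} {o} acc 2∣o bnd eq =
  trans (remʳ-column w (2 + o ∷ acc) (even⇒even+2 2∣o)
          (≤-refl ∷ All.map (λ p → ≤-trans p (m≤n+m _ 2)) bnd)
          (trans (step d (length acc)) (cong (suc ∘ suc) (trans eq (cong (λ r → o + length r) (sym skip))))))
        (cong (column (2 + o) (removed d w) ʳ++_) skip)
  where
  skip = remʳ-gap acc (All.map (λ {x} x≤o → <⇒≢ (s≤s (s≤s x≤o))) bnd)
  step : ∀ d m → 2 * d + 2 * suc m ≡ 2 + (2 * d + 2 * m)
  step = solve-∀
remʳ-column (both ∷ w) {zero} {o} acc 2∣o bnd eq =
  trans (remʳ-column w (2 + o ∷ suc o ∷ acc) (even⇒even+2 2∣o)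
          (≤-refl ∷ n≤1+n _ ∷ All.map (λ p → ≤-trans p (m≤n+m _ 2)) bnd)
          (trans (step (length acc)) (trans (cong (λ e → 4 + e) eq) (trans (shift o (length (remʳ acc))) (cong (λ r → 2 + o + length r) (sym cut))))))
        (cong (column (2 + o) (removed 0 w) ʳ++_) cut)
  where
  step : ∀ m → 2 * 0 + 2 * (2 + m) ≡ 4 + (2 * 0 + 2 * m)
  step = solve-∀
  shift : ∀ o m → 4 + (o + m) ≡ 2 + o + (2 + m)
  shift = solve-∀
  bound : ∀ o m → suc (2 + o + m + 1) ≡ 4 + (o + m)
  bound = solve-∀
  -- With no unmatched empty pair the balance reads `2 * length acc ≡ o + length (remʳ acc)`, so the
  -- removal test holds with the two sides differing by exactly one.
  cut = remʳ-remove acc 2∣o (≤-reflexive (trans (bound o _) (trans (cong (λ e → 4 + e) (sym eq)) (sym (step (length acc))))))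
remʳ-column (both ∷ w) {suc d} {o} acc 2∣o bnd eq =
  trans (remʳ-column w (2 + o ∷ suc o ∷ acc) (even⇒even+2 2∣o)
          (≤-refl ∷ n≤1+n _ ∷ All.map (λ p → ≤-trans p (m≤n+m _ 2)) bnd)
          (trans (step d (length acc)) (cong (suc ∘ suc) (trans eq (cong (λ r → o + length r) (sym keep))))))
        (cong (column (2 + o) (removed d w) ʳ++_) keep)
  where
  step : ∀ d m → 2 * d + 2 * (2 + m) ≡ 2 + (2 * suc d + 2 * m)
  step = solve-∀
  bound : ∀ o m → 2 + o + m + 1 ≡ 3 + (o + m)
  bound = solve-∀
  expand : ∀ d m → 3 + (2 * suc d + 2 * m) ≡ 2 * (2 + m) + (1 + 2 * d)
  expand = solve-∀
  -- With `suc d` unmatched empty pairs the left side of the removal test exceeds the right one by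
  -- `1 + 2 * d`, so the test fails.
  keep = remʳ-keep acc 2∣o (≤⇒≯ (≤-trans (m≤m+n _ (1 + 2 * d))
           (≤-reflexive (trans (sym (expand d (length acc))) (trans (cong (λ e → 3 + e) eq) (sym (bound o _)))))))

rem-column : ∀ w → rem (column 0 w) ≡ column 0 (removed 0 w)
rem-column w = trans (cong reverse (remʳ-column w [] (divides 0 refl) [] refl))
                     (reverse-involutive (column 0 (removed 0 w)))

-- The list `r` stays the whole removal subword while `w` shrinks. It may contain entries already
-- read, so membership is compared only above the offset.
filter-column : ∀ w {d o} r → (∀ {z} → o < z → (z ∈ r ⇔ z ∈ column o (removed d w))) →
                filter (λ z → ¬? (z ∈? r)) (column o w) ≡ column o (reduce d w)
filter-column w r mem = go w mem
  where
  accept : ∀ {x xs ys} → x ∉ r → filter (λ z → ¬? (z ∈? r)) xs ≡ ys →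
           filter (λ z → ¬? (z ∈? r)) (x ∷ xs) ≡ x ∷ ys
  accept x∉r eq = trans (filter-accept (λ z → ¬? (z ∈? r)) x∉r) (cong (_ ∷_) eq)
  reject : ∀ {x xs ys} → x ∈ r → filter (λ z → ¬? (z ∈? r)) xs ≡ ys →
           filter (λ z → ¬? (z ∈? r)) (x ∷ xs) ≡ ys
  reject x∈r eq = trans (filter-reject (λ z → ¬? (z ∈? r)) (λ x∉r → x∉r x∈r)) eq
  fresh : ∀ {o z w} → z ≤ o → z ∉ column o w
  fresh {o} {w = w} z≤o z∈ = <⇒≱ (All.lookup (column-> o w) z∈) z≤o
  later : ∀ {o z} → 2 + o < z → o < z
  later p = ≤-trans (m≤n+m _ 2) p
  go : ∀ w {d o} → (∀ {z} → o < z → (z ∈ r ⇔ z ∈ column o (removed d w))) →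
       filter (λ z → ¬? (z ∈? r)) (column o w) ≡ column o (reduce d w)
  go [] mem = refl
  go (none ∷ w) mem = go w (mem ∘ later)
  go (low  ∷ w) {d} mem =
    accept (fresh {w = removed d w} (n≤1+n _) ∘ Equivalence.to (mem ≤-refl)) (go w (mem ∘ later))
  go (high ∷ w) {d} mem =
    accept (fresh {w = removed d w} ≤-refl ∘ Equivalence.to (mem (n≤1+n _))) (go w (mem ∘ later))
  go (both ∷ w) {zero} mem =
    reject (Equivalence.from (mem ≤-refl) (here refl))
      (reject (Equivalence.from (mem (n≤1+n _)) (there (here refl)))
        -- Only entries above the removed pair matter from here on, so both of its entries drop out
        -- of the comparison.
        (go w (λ p → mk⇔ (tail p ∘ Equivalence.to (mem (later p))) (Equivalence.from (mem (later p)) ∘ there ∘ there))))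
    where
    tail : ∀ {o z ws} → 2 + o < z → z ∈ suc o ∷ 2 + o ∷ ws → z ∈ ws
    tail p (here refl)         = contradiction p (<-asym (n<1+n _))
    tail p (there (here refl)) = contradiction p (<-irrefl refl)
    tail p (there (there z∈))  = z∈
  go (both ∷ w) {suc d} mem =
    accept (fresh {w = removed d w} (n≤1+n _) ∘ Equivalence.to (mem ≤-refl))
      (accept (fresh {w = removed d w} ≤-refl ∘ Equivalence.to (mem (n≤1+n _))) (go w (mem ∘ later)))

red-column : ∀ w → red (column 0 w) ≡ column 0 (reduce 0 w)
red-column w = filter-column w (rem (column 0 w))
  (λ {z} _ → mk⇔ (subst (z ∈_) (rem-column w)) (subst (z ∈_) (sym (rem-column w))))

-- For equal results, starting with fewer unmatched empty pairs means removing at least as much.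
size-antitone : ∀ u v {d e} → d < e → reduce d u ≡ reduce e v → size v ≤ size u
size-antitone []         []         d<e eq = z≤n
size-antitone (none ∷ u) (none ∷ v) d<e eq = size-antitone u v (s≤s d<e) (∷-injectiveʳ eq)
size-antitone (low  ∷ u) (low  ∷ v) d<e eq = s≤s (size-antitone u v d<e (∷-injectiveʳ eq))
size-antitone (high ∷ u) (high ∷ v) d<e eq = s≤s (size-antitone u v d<e (∷-injectiveʳ eq))
size-antitone (both ∷ u) (both ∷ v) {suc d} (s≤s d<e) eq = s≤s (s≤s (size-antitone u v d<e (∷-injectiveʳ eq)))
size-antitone []         (both ∷ v) (s≤s _) ()
size-antitone (none ∷ u) (both ∷ v) (s≤s _) ()
size-antitone (low  ∷ u) (both ∷ v) (s≤s _) ()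
size-antitone (high ∷ u) (both ∷ v) (s≤s _) ()
size-antitone (both ∷ u) (both ∷ v) {zero} (s≤s _) ()
-- The only case where sizes diverge: `u` loses a full pair and stays at zero, while `v` has pushed
-- one more empty pair, so the strict inequality persists.
size-antitone (both ∷ u) (none ∷ v) {zero} d<e eq = m≤n⇒m≤o+n 2 (size-antitone u v (s≤s z≤n) (∷-injectiveʳ eq))

-- The only possible disagreement is a full pair met by the empty stack against an empty pair. From
-- there the counters are zero and one, and `size-antitone` makes the word with the full pair larger
-- by at least two.
reduce-injective : ∀ u v {d} → size u ≡ size v → reduce d u ≡ reduce d v → u ≡ v
reduce-injective []         []         sz eq = refl
reduce-injective (none ∷ u) (none ∷ v) sz eq =
  cong (none ∷_) (reduce-injective u v sz (∷-injectiveʳ eq))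
reduce-injective (low  ∷ u) (low  ∷ v) sz eq =
  cong (low ∷_) (reduce-injective u v (suc-injective sz) (∷-injectiveʳ eq))
reduce-injective (high ∷ u) (high ∷ v) sz eq =
  cong (high ∷_) (reduce-injective u v (suc-injective sz) (∷-injectiveʳ eq))
reduce-injective (both ∷ u) (both ∷ v) {zero} sz eq =
  cong (both ∷_) (reduce-injective u v (suc-injective (suc-injective sz)) (∷-injectiveʳ eq))
reduce-injective (both ∷ u) (both ∷ v) {suc d} sz eq =
  cong (both ∷_) (reduce-injective u v (suc-injective (suc-injective sz)) (∷-injectiveʳ eq))
reduce-injective []         (both ∷ v) {zero} sz ()
reduce-injective (low  ∷ u) (both ∷ v) {zero} sz ()
reduce-injective (high ∷ u) (both ∷ v) {zero} sz ()
reduce-injective (both ∷ u) (none ∷ v) {zero} sz eq =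
  contradiction (≤-trans (n≤1+n _) (≤-trans (≤-reflexive sz) (size-antitone u v (s≤s z≤n) (∷-injectiveʳ eq)))) (<-irrefl refl)
reduce-injective (none ∷ u) (both ∷ v) {zero} sz eq =
  contradiction (≤-trans (n≤1+n _) (≤-trans (≤-reflexive (sym sz)) (size-antitone v u (s≤s z≤n) (∷-injectiveʳ (sym eq))))) (<-irrefl refl)

-- Filling empty pairs

fill : ℕ → Word → Word
fill zero    w          = w
fill (suc m) []         = []
fill (suc m) (none ∷ w) = both ∷ fill m w
fill (suc m) (low  ∷ w) = low ∷ fill (suc m) w
fill (suc m) (high ∷ w) = high ∷ fill (suc m) w
fill (suc m) (both ∷ w) = both ∷ fill (suc m) w

free : Word → ℕ
free []         = 0
free (none ∷ w) = suc (free w)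
free (low  ∷ w) = free w
free (high ∷ w) = free w
free (both ∷ w) = free w

-- The shape of the words of the blocks `X i`: the partner of an entry of `X i` is absent from `a`.
Sparse : Word → Set
Sparse = All (_≢ both)

free-++ : ∀ u v → free (u ++ v) ≡ free u + free v
free-++ []         v = refl
free-++ (none ∷ u) v = cong suc (free-++ u v)
free-++ (low  ∷ u) v = free-++ u v
free-++ (high ∷ u) v = free-++ u v
free-++ (both ∷ u) v = free-++ u v

size-++ : ∀ u v → size (u ++ v) ≡ size u + size v
size-++ []         v = refl
size-++ (none ∷ u) v = size-++ u v
size-++ (low  ∷ u) v = cong suc (size-++ u v)
size-++ (high ∷ u) v = cong suc (size-++ u v)
size-++ (both ∷ u) v = cong (suc ∘ suc) (size-++ u v)

free-none : ∀ g → free (replicate g none) ≡ g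
free-none zero    = refl
free-none (suc g) = cong suc (free-none g)

size-none : ∀ g → size (replicate g none) ≡ 0
size-none zero    = refl
size-none (suc g) = size-none g

size-both : ∀ q → size (replicate q both) ≡ 2 * q
size-both zero    = refl
size-both (suc q) = trans (cong (suc ∘ suc) (size-both q)) (sym (*-suc 2 q))

sparse-none : ∀ g → Sparse (replicate g none)
sparse-none zero    = []
sparse-none (suc g) = (λ ()) ∷ sparse-none g

-- A pair of a sparse word is either empty or holds exactly one entry.
sparse-length : ∀ {w} → Sparse w → length w ≡ free w + size w
sparse-length {[]}       []        = refl
sparse-length {none ∷ w} (_ ∷ spw) = cong suc (sparse-length spw)
sparse-length {low  ∷ w} (_ ∷ spw) = trans (cong suc (sparse-length spw)) (sym (+-suc (free w) (size w)))
sparse-length {high ∷ w} (_ ∷ spw) = trans (cong suc (sparse-length spw)) (sym (+-suc (free w) (size w)))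
sparse-length {both ∷ w} (≢both ∷ _) = contradiction refl ≢both

fill-++ : ∀ m u v → fill m (u ++ v) ≡ fill m u ++ fill (m ∸ free u) v
fill-++ zero    u          v = cong (λ m → u ++ fill m v) (sym (0∸n≡0 (free u)))
fill-++ (suc m) []         v = refl
fill-++ (suc m) (none ∷ u) v = cong (both ∷_) (fill-++ m u v)
fill-++ (suc m) (low  ∷ u) v = cong (low ∷_) (fill-++ (suc m) u v)
fill-++ (suc m) (high ∷ u) v = cong (high ∷_) (fill-++ (suc m) u v)
fill-++ (suc m) (both ∷ u) v = cong (both ∷_) (fill-++ (suc m) u v)

length-fill : ∀ m w → length (fill m w) ≡ length w
length-fill zero    w          = refl
length-fill (suc m) []         = refl
length-fill (suc m) (none ∷ w) = cong suc (length-fill m w)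
length-fill (suc m) (low  ∷ w) = cong suc (length-fill (suc m) w)
length-fill (suc m) (high ∷ w) = cong suc (length-fill (suc m) w)
length-fill (suc m) (both ∷ w) = cong suc (length-fill (suc m) w)

size-fill : ∀ {m} w → m ≤ free w → size (fill m w) ≡ size w + 2 * m
size-fill {zero}  w          _         = sym (+-identityʳ (size w))
size-fill {suc m} (none ∷ w) (s≤s m≤)  = trans (cong (suc ∘ suc) (size-fill w m≤)) (shift (size w) m)
  where
  shift : ∀ a m → 2 + (a + 2 * m) ≡ a + 2 * suc m
  shift = solve-∀
size-fill {suc m} (low  ∷ w) m≤ = cong suc (size-fill w m≤)
size-fill {suc m} (high ∷ w) m≤ = cong suc (size-fill w m≤)
size-fill {suc m} (both ∷ w) m≤ = cong (suc ∘ suc) (size-fill w m≤)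

fill-entry : ∀ m {P} → P ≢ none → fill m (P ∷ []) ≡ P ∷ []
fill-entry zero    P≢none = refl
fill-entry (suc m) {none} P≢none = contradiction refl P≢none
fill-entry (suc m) {low}  _ = refl
fill-entry (suc m) {high} _ = refl
fill-entry (suc m) {both} _ = refl

reduce-sparse : ∀ {u} d v → Sparse u → reduce d (u ++ v) ≡ u ++ reduce (free u + d) v
reduce-sparse {[]}       d v [] = refl
reduce-sparse {none ∷ u} d v (_ ∷ spu) =
  cong (none ∷_) (trans (reduce-sparse (suc d) v spu) (cong (λ e → u ++ reduce e v) (+-suc (free u) d)))
reduce-sparse {low  ∷ u} d v (_ ∷ spu) = cong (low ∷_) (reduce-sparse d v spu)
reduce-sparse {high ∷ u} d v (_ ∷ spu) = cong (high ∷_) (reduce-sparse d v spu)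
reduce-sparse {both ∷ u} d v (≢both ∷ _) = contradiction refl ≢both

-- The first `m` empty pairs are the ones filled, so nothing is pushed before the last of them is
-- read: each filled pair meets the empty stack and is emptied again. The remaining empty pairs are
-- pushed.
reduce-fill-zero : ∀ {m u} v → Sparse u → m ≤ free u →
                   reduce 0 (fill m u ++ v) ≡ u ++ reduce (free u ∸ m) v
reduce-fill-zero {zero}  {u} v spu _ =
  trans (reduce-sparse 0 v spu) (cong (λ e → u ++ reduce e v) (+-identityʳ (free u)))
reduce-fill-zero {suc m} {none ∷ u} v (_ ∷ spu) (s≤s m≤) = cong (none ∷_) (reduce-fill-zero v spu m≤)
reduce-fill-zero {suc m} {low  ∷ u} v (_ ∷ spu) m≤ = cong (low ∷_) (reduce-fill-zero v spu m≤)
reduce-fill-zero {suc m} {high ∷ u} v (_ ∷ spu) m≤ = cong (high ∷_) (reduce-fill-zero v spu m≤)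
reduce-fill-zero {suc m} {both ∷ u} v (≢both ∷ _) m≤ = contradiction refl ≢both

-- Here `d` and `f` count unmatched empty pairs before and after a block with `a` empty pairs, of
-- which `m` are to be filled. If both `d` and `m` were positive, filled pairs would be matched and
-- kept; the disjunction rules this out.
balanced⇒fits : ∀ {d m a f} → d ≡ 0 ⊎ m ≡ 0 → d + a ≡ m + f → m ≤ a
balanced⇒fits {m = m} {f = f} (inj₁ refl) eq = ≤-trans (m≤m+n m f) (≤-reflexive (sym eq))
balanced⇒fits (inj₂ refl) eq = z≤n

reduce-fill : ∀ {d m u f} v → Sparse u → d ≡ 0 ⊎ m ≡ 0 → d + free u ≡ m + f →
              reduce d (fill m u ++ v) ≡ u ++ reduce f v
reduce-fill {m = m} {u} {f} v spu (inj₁ refl) eq =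
  trans (reduce-fill-zero v spu (balanced⇒fits {0} (inj₁ refl) eq))
        (cong (λ e → u ++ reduce e v) (trans (cong (_∸ m) eq) (m+n∸m≡n m f)))
reduce-fill {d = d} {u = u} v spu (inj₂ refl) eq =
  trans (reduce-sparse d v spu) (cong (λ e → u ++ reduce e v) (trans (+-comm (free u) d) eq))

-- Enough empty pairs are waiting, so each full pair is matched and kept.
reduce-both : ∀ q {d} v → reduce (q + d) (replicate q both ++ v) ≡ replicate q both ++ reduce d v
reduce-both zero    v = refl
reduce-both (suc q) v = cong (both ∷_) (reduce-both q v)

-- Columns of runs of pairs

applyUpTo-cong : ∀ {A : Set} {f g : ℕ → A} n → (∀ i → f i ≡ g i) → applyUpTo f n ≡ applyUpTo g n
applyUpTo-cong zero    f≗g = refl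
applyUpTo-cong (suc n) f≗g = cong₂ _∷_ (f≗g 0) (applyUpTo-cong n (f≗g ∘ suc))

interval-pair : ∀ o q → interval (suc o) (2 * suc q) ≡ suc o ∷ 2 + o ∷ interval (3 + o) (2 * q)
interval-pair o q = trans (cong (interval (suc o)) (*-suc 2 q))
  (cong₂ _∷_ (cong suc (+-identityʳ o)) (cong₂ _∷_ (cong suc (+-comm o 1))
    (applyUpTo-cong (2 * q) (λ d → cong suc (trans (+-suc o (suc d)) (cong suc (+-suc o d)))))))

column-both : ∀ o q → column o (replicate q both) ≡ interval (suc o) (2 * q)
column-both o zero    = refl
column-both o (suc q) = trans (cong (λ xs → suc o ∷ 2 + o ∷ xs) (column-both (2 + o) q)) (sym (interval-pair o q))

column-none : ∀ o g → column o (replicate g none) ≡ []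
column-none o zero    = refl
column-none o (suc g) = column-none (2 + o) g

-- This produces the segments `Tseg`: `g` is half a gap, `m` half of what remains to be inserted,
-- and their minimum is the one in the recursion for `ℓ`.
column-fill-none : ∀ o m g → column o (fill m (replicate g none)) ≡ interval (suc o) (2 * (m ⊓ g))
column-fill-none o zero    g       = column-none o g
column-fill-none o (suc m) zero    = refl
column-fill-none o (suc m) (suc g) =
  trans (cong (λ xs → suc o ∷ 2 + o ∷ xs) (column-fill-none (2 + o) m g)) (sym (interval-pair o (m ⊓ g)))

-- Entries and gaps

-- The even end of the pair containing `x`, hence the offset of the next pair. The segment following
-- `x` starts at `suc (ceil x)` for either parity.
ceil : ℕ → ℕ
ceil x = if even? x then x else suc x

entry : ℕ → Pair
entry x = if even? x then high else low

parity : ∀ x → 2 ∣ x ⊎ 2 ∣ suc x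
parity zero    = inj₁ (divides 0 refl)
parity (suc x) with parity x
... | inj₁ 2∣x   = inj₂ (even⇒even+2 2∣x)
... | inj₂ 2∣1+x = inj₁ 2∣1+x

suc-even⇒odd : ∀ {x} → 2 ∣ suc x → ¬ 2 ∣ x
suc-even⇒odd 2∣1+x 2∣x = even⇒suc-odd 2∣x 2∣1+x

ceil-even : ∀ {x} → 2 ∣ x → ceil x ≡ x
ceil-even 2∣x rewrite even?-even 2∣x = refl

ceil-odd : ∀ {x} → 2 ∣ suc x → ceil x ≡ suc x
ceil-odd 2∣1+x rewrite even?-odd (suc-even⇒odd 2∣1+x) = refl

2∣ceil : ∀ x → 2 ∣ ceil x
2∣ceil x with parity x
... | inj₁ 2∣x   = subst (2 ∣_) (sym (ceil-even 2∣x)) 2∣x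
... | inj₂ 2∣1+x = subst (2 ∣_) (sym (ceil-odd 2∣1+x)) 2∣1+x

ceil-≤ : ∀ {x c} → 2 ∣ c → x ≤ c → ceil x ≤ c
ceil-≤ {x} 2∣c x≤c with parity x
... | inj₁ 2∣x   = ≤-trans (≤-reflexive (ceil-even 2∣x)) x≤c
... | inj₂ 2∣1+x = ≤-trans (≤-reflexive (ceil-odd 2∣1+x)) (≤∧≢⇒< x≤c (λ { refl → suc-even⇒odd 2∣1+x 2∣c }))

column-entry : ∀ {o} x → ceil x ≡ 2 + o → column o (entry x ∷ []) ≡ x ∷ []
column-entry x eq with even? x
column-entry x refl | true  = refl
column-entry x refl | false = refl

entry≢none : ∀ x → entry x ≢ none
entry≢none x with even? x
... | true  = λ ()
... | false = λ ()

entry≢both : ∀ x → entry x ≢ both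
entry≢both x with even? x
... | true  = λ ()
... | false = λ ()

free-entry : ∀ x → free (entry x ∷ []) ≡ 0
free-entry x with even? x
... | true  = refl
... | false = refl

size-entry : ∀ x → size (entry x ∷ []) ≡ 1
size-entry x with even? x
... | true  = refl
... | false = refl

even-diff : ∀ {a b} → 2 ∣ a → 2 ∣ b → a ≤ b → ∃[ g ] b ≡ a + 2 * g
even-diff {a} {b} 2∣a 2∣b a≤b with m≤n⇒∃[o]m+o≡n a≤b
... | o , refl with ∣m+n∣m⇒∣n 2∣b 2∣a
... | divides g refl = g , cong (λ e → a + e) (*-comm g 2)

even-gap : ∀ {a b} → 2 ∣ a → 2 ∣ b → a < b → ∃[ g ] b ≡ 2 + a + 2 * g
even-gap 2∣a 2∣b a<b =
  even-diff (even⇒even+2 2∣a) 2∣b (≤∧≢⇒< a<b (λ { refl → even⇒suc-odd 2∣a 2∣b }))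

-- Differences and minima of doubled numbers

minus-pos : ∀ a b → + (a + b) ℤ.- + a ≡ + b
minus-pos a b = trans (ℤ.m-n≡m⊖n (a + b) a) (trans (ℤ.⊖-≥ (m≤m+n a b)) (cong +_ (m+n∸m≡n a b)))

minus-pos₂ : ∀ {a} b c d → a ≡ c + b + d → + a ℤ.- + b ℤ.- + c ≡ + d
minus-pos₂ b c d refl = trans (cong (λ z → + z ℤ.- + b ℤ.- + c) (shift b c d))
  (trans (cong (ℤ._- + c) (minus-pos b (c + d))) (minus-pos c d))
  where
  shift : ∀ b c d → c + b + d ≡ b + (c + d)
  shift = solve-∀

minus-pos-≤ : ∀ {a b} → b ≤ a → + (2 * a) ℤ.- + (2 * b) ≡ + (2 * (a ∸ b))
minus-pos-≤ {a} {b} b≤a = trans (cong (λ z → + z ℤ.- + (2 * b)) (trans (cong (2 *_) (sym (m+[n∸m]≡n b≤a))) (*-distribˡ-+ 2 b (a ∸ b))))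
  (minus-pos (2 * b) (2 * (a ∸ b)))

⊓-double : ∀ a b (z : ℤ) → (+ (2 * a) ℤ.- z) ℤ.⊓ (+ (2 * b) ℤ.- z) ≡ + (2 * (a ⊓ b)) ℤ.- z
⊓-double a b z with ≤-total a b
... | inj₁ a≤b = trans (ℤ.i≤j⇒i⊓j≡i (ℤ.+-monoˡ-≤ (ℤ.- z) (ℤ.+≤+ (*-monoʳ-≤ 2 a≤b))))
                       (cong (λ c → + (2 * c) ℤ.- z) (sym (m≤n⇒m⊓n≡m a≤b)))
... | inj₂ b≤a = trans (ℤ.i≥j⇒i⊓j≡j (ℤ.+-monoˡ-≤ (ℤ.- z) (ℤ.+≤+ (*-monoʳ-≤ 2 b≤a))))
                       (cong (λ c → + (2 * c) ℤ.- z) (sym (m≥n⇒m⊓n≡n b≤a)))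

foldr-⊓-double : ∀ r {f : ℕ → ℤ} {g : ℕ → ℕ} {z c s} →
                 z ≡ + (2 * c) ℤ.- s → (∀ {d} → d < r → f d ≡ + (2 * g d) ℤ.- s) →
                 foldr ℤ._⊓_ z (applyUpTo f r) ≡ + (2 * foldr _⊓_ c (applyUpTo g r)) ℤ.- s
foldr-⊓-double zero    z≡ f≡ = z≡
foldr-⊓-double (suc r) {g = g} {c = c} {s} z≡ f≡ =
  trans (cong₂ ℤ._⊓_ (f≡ (s≤s z≤n)) (foldr-⊓-double r {g = g ∘ suc} {c = c} {s} z≡ (f≡ ∘ s≤s)))
        (⊓-double (g 0) (foldr _⊓_ c (applyUpTo (g ∘ suc) r)) s)

-- Greedy filling of two successive runs with `f` and `g` empty pairs amounts to greedy filling of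
-- their concatenation.
⊓-+ : ∀ m f g → m ⊓ f + (m ∸ f) ⊓ g ≡ m ⊓ (f + g)
⊓-+ m       zero    g = cong (_+ m ⊓ g) (⊓-zeroʳ m)
⊓-+ zero    (suc f) g = refl
⊓-+ (suc m) (suc f) g = cong suc (⊓-+ m f g)

-- Sorted lists

module _ {A : Set} {R : A → A → Set} where

  AllPairs-++⁻ˡ : ∀ xs {ys} → AllPairs R (xs ++ ys) → AllPairs R xs
  AllPairs-++⁻ˡ []       _          = []
  AllPairs-++⁻ˡ (x ∷ xs) (px ∷ pxs) = All.++⁻ˡ xs px ∷ AllPairs-++⁻ˡ xs pxs

  AllPairs-++⁻ʳ : ∀ xs {ys} → AllPairs R (xs ++ ys) → AllPairs R ys
  AllPairs-++⁻ʳ []       pys       = pys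
  AllPairs-++⁻ʳ (x ∷ xs) (_ ∷ pxs) = AllPairs-++⁻ʳ xs pxs

  AllPairs-across : ∀ xs {ys x y} → AllPairs R (xs ++ ys) → x ∈ xs → y ∈ ys → R x y
  AllPairs-across (_ ∷ xs) (px ∷ _)  (here refl) y∈ = All.lookup (All.++⁻ʳ xs px) y∈
  AllPairs-across (_ ∷ xs) (_ ∷ pxs) (there x∈)  y∈ = AllPairs-across xs pxs x∈ y∈

  AllPairs-applyUpTo⁻ : ∀ f {n i} → AllPairs R (applyUpTo f n) → suc i < n → R (f i) (f (suc i))
  AllPairs-applyUpTo⁻ f {suc (suc n)} {zero}  ((r ∷ _) ∷ _) _ = r
  AllPairs-applyUpTo⁻ f {suc n} {suc i} (_ ∷ pxs) (s≤s i<n) = AllPairs-applyUpTo⁻ (f ∘ suc) pxs i<n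

-- Nonnegativity and evenness in one equation, which also carries the integer recursion over to ℕ.
EvenNat : ℤ → Set
EvenNat z = ∃[ q ] z ≡ + (2 * q)

even-nonneg : ∀ {z} → EvenNat z → 0ℤ ℤ.≤ z × + 2 ℤ.∣ z
even-nonneg (q , refl) = ℤ.+≤+ z≤n , m∣m*n q

Linked-positive : ∀ {b} → All (1 ≤_) b → Linked _<_ b → Linked _<_ (0 ∷ b)
Linked-positive []        _   = [-]
Linked-positive (0<x ∷ _) lnk = 0<x ∷ lnk

module Preimage (n l k : ℕ) (t p α : ℕ → ℕ) (x : ℕ → ℕ → ℕ) where

  open Construction k t p α x

  module Properties
    (t-even    : ∀ i → 1 ≤ i → i ≤ k → 1 ≤ t i × 2 ∣ t i)
    (l≤2n      : l ≤ 2 * n)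
    (t≤l⊓      : t⁽ k ⁾ ≤ l ⊓ (2 * n ∸ l))
    (l-t-even  : 2 ∣ l ∸ t⁽ k ⁾)
    (a-SpT     : IsSpT n t⁽ k ⁾ a)
    (s[X]∉a    : ∀ i → i ≤ k → ∀ y → y ∈ X i → s y ∉ a)
    (α-odd     : ∀ i → 1 ≤ i → i ≤ k → ¬ 2 ∣ α i)
    (α-large   : ∀ i → i < k → 2 * t⁽ i ⁾ + t (suc i) + 1 ≤ α (suc i))
    where

    -- Order of the entries of a

    a-prefix : ∀ {i j} → i ≤′ j → ∃[ r ] a-upTo j ≡ a-upTo i ++ r
    a-prefix ≤′-refl = [] , sym (++-identityʳ _)
    a-prefix {i} {suc j} (≤′-step i≤j) with a-prefix i≤j
    ... | r , eq = r ++ A (suc j) ++ X (suc j) ,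
                   trans (cong (_++ A (suc j) ++ X (suc j)) eq) (++-assoc (a-upTo i) r _)

    a-entries : All (λ y → 1 ≤ y × y ≤ 2 * n) a
    a-entries = IsSST.entries (IsSpT.isSST a-SpT)

    -- The extra `0` is the conventional value `x̂ 0 0`, so that every left end of a gap lies in a
    -- sorted list.
    sorted : ∀ {i} → i ≤ k → AllPairs _<_ (0 ∷ a-upTo i)
    sorted {i} i≤k with a-prefix (≤⇒≤′ i≤k)
    ... | r , eq = AllPairs-++⁻ˡ (0 ∷ a-upTo i) (subst (AllPairs _<_ ∘ (0 ∷_)) eq
      (All.map proj₁ a-entries ∷ Linked⇒AllPairs <-trans (IsSST.increasing (IsSpT.isSST a-SpT))))

    X-sorted : ∀ i → i ≤ k → AllPairs _<_ (X i)
    X-sorted zero    i≤k with sorted i≤k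
    ... | _ ∷ prs = prs
    X-sorted (suc i) i≤k = AllPairs-++⁻ʳ (A (suc i)) (AllPairs-++⁻ʳ (0 ∷ a-upTo i) (sorted i≤k))

    X⊆upTo : ∀ i {y} → y ∈ X i → y ∈ a-upTo i
    X⊆upTo zero    y∈ = y∈
    X⊆upTo (suc i) y∈ = ∈-++⁺ʳ (a-upTo i) (∈-++⁺ʳ (A (suc i)) y∈)

    upTo⊆a : ∀ {i y} → i ≤ k → y ∈ a-upTo i → y ∈ a
    upTo⊆a i≤k y∈ with a-prefix (≤⇒≤′ i≤k)
    ... | r , eq = subst (_ ∈_) (sym eq) (∈-++⁺ˡ y∈)

    x∈X : ∀ {i j} → j < p i → x i (suc j) ∈ X i
    x∈X {i} = ∈-applyUpTo⁺ (λ j → x i (suc j))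

    A-last : ∀ {i} → suc i ≤ k → x̂ (suc i) 0 ∈ A (suc i)
    A-last {i} i<k with t (suc i) | proj₁ (t-even (suc i) (s≤s z≤n) i<k)
    ... | suc m | _ = subst (_∈ interval (α (suc i)) (suc m)) (cong (_∸ 1) (sym (+-suc (α (suc i)) m)))
                        (∈-applyUpTo⁺ (λ d → α (suc i) + d) ≤-refl)

    A-first : ∀ {i} → suc i ≤ k → α (suc i) ∈ A (suc i)
    A-first {i} i<k = subst (_∈ A (suc i)) (+-identityʳ _)
      (∈-applyUpTo⁺ (λ d → α (suc i) + d) (proj₁ (t-even (suc i) (s≤s z≤n) i<k)))

    x̂-suc : ∀ i j → x̂ i (suc j) ≡ x i (suc j)
    x̂-suc zero    j = refl
    x̂-suc (suc i) j = refl

    x̂-last : ∀ i → i ≤ k → x̂ i (p i) ∈ 0 ∷ a-upTo i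
    x̂-last i i≤k = go i (p i) refl i≤k
      where
      go : ∀ i q → q ≡ p i → i ≤ k → x̂ i q ∈ 0 ∷ a-upTo i
      go zero    zero    _  _   = here refl
      go (suc i) zero    _  i<k = there (∈-++⁺ʳ (a-upTo i) (∈-++⁺ˡ (A-last i<k)))
      go i       (suc q) eq _   = subst (_∈ 0 ∷ a-upTo i) (sym (x̂-suc i q))
        (there (X⊆upTo i (x∈X (≤-reflexive eq))))

    x̂-last-< : ∀ {i} → i < k → x̂ i (p i) < α (suc i)
    x̂-last-< {i} i<k = AllPairs-across (0 ∷ a-upTo i) (sorted i<k) (x̂-last i (<⇒≤ i<k)) (∈-++⁺ˡ (A-first i<k))

    x̂-last-≤ : x̂ k (p k) ≤ 2 * n
    x̂-last-≤ with x̂-last k ≤-refl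
    ... | here  eq = ≤-trans (≤-reflexive eq) z≤n
    ... | there x∈ = proj₂ (All.lookup a-entries x∈)

    x̂₀-< : ∀ i → i ≤ k → 0 < p i → x̂ i 0 < x i 1
    x̂₀-< zero    i≤k 0<p with sorted i≤k
    ... | 0< ∷ _ = All.lookup 0< (x∈X 0<p)
    x̂₀-< (suc i) i≤k 0<p =
      AllPairs-across (A (suc i)) (AllPairs-++⁻ʳ (0 ∷ a-upTo i) (sorted i≤k)) (A-last i≤k) (x∈X 0<p)

    x-< : ∀ {i j} → i ≤ k → suc j < p i → x i (suc j) < x i (2 + j)
    x-< {i} i≤k = AllPairs-applyUpTo⁻ (λ j → x i (suc j)) (X-sorted i i≤k)

    -- Ensures that consecutive entries of `X i` never share a pair.
    s[x]≢x : ∀ {i j} → i ≤ k → suc j < p i → s (x i (suc j)) ≢ x i (2 + j)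
    s[x]≢x {i} i≤k j<p eq = s[X]∉a i i≤k _ (x∈X (<-trans (n<1+n _) j<p))
      (subst (_∈ a) (sym eq) (upTo⊆a i≤k (X⊆upTo i (x∈X j<p))))

    -- Parities and gaps

    τ : ℕ → ℕ
    τ i = t i / 2

    t≡2τ : ∀ {i} → i < k → t (suc i) ≡ 2 * τ (suc i)
    t≡2τ {i} i<k = sym (m*[n/m]≡n (proj₂ (t-even (suc i) (s≤s z≤n) i<k)))

    -- The number of empty pairs of `a` unmatched after `A (suc i)`. By `α≡`,
    -- `t⁽ i ⁾ + τ (suc i) + slack/2 i` pairs precede `A (suc i)`: `t⁽ i ⁾` of them carry entries or
    -- are matched with earlier intervals, and `τ (suc i)` are matched with `A (suc i)`. The bound
    -- and the parity of `α (suc i)` make the truncated operations exact.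
    slack/2 : ℕ → ℕ
    slack/2 i = (α (suc i) ∸ (2 * t⁽ i ⁾ + t (suc i) + 1)) / 2

    α≡ : ∀ {i} → i < k → α (suc i) ≡ 1 + 2 * (t⁽ i ⁾ + τ (suc i) + slack/2 i)
    α≡ {i} i<k with m≤n⇒∃[o]m+o≡n (α-large i i<k)
    ... | o , eq = trans (sym eq) (trans (cong₂ (λ t y → 2 * t⁽ i ⁾ + t + 1 + y) (t≡2τ i<k) o≡) (shift t⁽ i ⁾ (τ (suc i)) _))
      where
      shift : ∀ T τ y → 2 * T + 2 * τ + 1 + 2 * y ≡ 1 + 2 * (T + τ + y)
      shift = solve-∀
      odd-shift : ∀ T τ y → 2 * T + 2 * τ + 1 + y ≡ 2 * (T + τ) + suc y
      odd-shift = solve-∀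
      2∣o : 2 ∣ o
      2∣o with parity o
      ... | inj₁ 2∣o   = 2∣o
      -- An odd `o` would make `α (suc i)` even.
      ... | inj₂ 2∣1+o = contradiction
        (subst (2 ∣_) (trans (sym (odd-shift t⁽ i ⁾ (τ (suc i)) o)) (trans (cong (λ t → 2 * t⁽ i ⁾ + t + 1 + o) (sym (t≡2τ i<k))) eq))
          (∣m∣n⇒∣m+n (m∣m*n (t⁽ i ⁾ + τ (suc i))) 2∣1+o))
        (α-odd (suc i) (s≤s z≤n) i<k)
      o≡ : o ≡ 2 * slack/2 i
      o≡ = trans (sym (m*[n/m]≡n 2∣o)) (cong (λ y → 2 * (y / 2))
             (trans (sym (m+n∸m≡n (2 * t⁽ i ⁾ + t (suc i) + 1) o)) (cong (_∸ (2 * t⁽ i ⁾ + t (suc i) + 1)) eq)))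

    slack≡ : ∀ {i} → i < k → slack i ≡ + (2 * slack/2 i)
    slack≡ {i} i<k = trans (cong (λ z → + z ℤ.- + (2 * t⁽ i ⁾) ℤ.- + t (suc i) ℤ.- + 1) α≡′)
      (trans (cong (λ z → z ℤ.- + t (suc i) ℤ.- + 1) (minus-pos (2 * t⁽ i ⁾) _))
        (trans (cong (λ z → z ℤ.- + 1) (minus-pos (t (suc i)) _)) (minus-pos 1 _)))
      where
      shift : ∀ T τ y → 1 + 2 * (T + τ + y) ≡ 2 * T + (2 * τ + (1 + 2 * y))
      shift = solve-∀
      α≡′ : α (suc i) ≡ 2 * t⁽ i ⁾ + (t (suc i) + (1 + 2 * slack/2 i))
      α≡′ = trans (α≡ i<k) (trans (shift t⁽ i ⁾ (τ (suc i)) _)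
              (cong (λ t → 2 * t⁽ i ⁾ + (t + (1 + 2 * slack/2 i))) (sym (t≡2τ i<k))))

    x̂₀≡ : ∀ {i} → i < k → x̂ (suc i) 0 ≡ 2 * (t⁽ i ⁾ + τ (suc i) + slack/2 i) + 2 * τ (suc i)
    x̂₀≡ i<k = cong₂ (λ a t → a + t ∸ 1) (α≡ i<k) (t≡2τ i<k)

    x̂₀-even : ∀ i → i ≤ k → 2 ∣ x̂ i 0
    x̂₀-even zero    _   = divides 0 refl
    x̂₀-even (suc i) i<k = subst (2 ∣_) (sym (x̂₀≡ i<k))
      (∣m∣n⇒∣m+n (m∣m*n (t⁽ i ⁾ + τ (suc i) + slack/2 i)) (m∣m*n (τ (suc i))))

    -- The offsets only compensate for rounding: the difference equals `ceil y - ceil e - 2`, twice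
    -- the number of pairs strictly between those of `e` and `y`.
    first-gap : ∀ {e y} → 2 ∣ e → e < y →
                ∃[ g ] ceil y ≡ 2 + ceil e + 2 * g × + y ℤ.- + e ℤ.- + offset₀ (even? y) ≡ + (2 * g)
    first-gap {e} {y} 2∣e e<y with parity y
    ... | inj₁ 2∣y with even-gap 2∣e 2∣y e<y
    ...   | g , eq rewrite even?-even 2∣y | ceil-even 2∣e = g , eq , minus-pos₂ e 2 (2 * g) eq
    first-gap {e} {y} 2∣e e<y | inj₂ 2∣1+y with even-gap 2∣e 2∣1+y (<-trans e<y (n<1+n y))
    ...   | g , eq rewrite even?-odd (suc-even⇒odd 2∣1+y) | ceil-even 2∣e =
      g , eq , minus-pos₂ e 1 (2 * g) (suc-injective eq)

    -- As in `first-gap`, all four offsets give `ceil z - ceil y - 2`.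
    next-gap : ∀ {y z} → y < z → s y ≢ z →
               ∃[ g ] ceil z ≡ 2 + ceil y + 2 * g ×
                      + z ℤ.- + y ℤ.- + offset (even? y) (even? z) ≡ + (2 * g)
    next-gap {y} {z} y<z sy≢z with parity y | parity z
    ... | inj₁ 2∣y | inj₁ 2∣z with even-gap 2∣y 2∣z y<z
    ...   | g , eq rewrite even?-even 2∣y | even?-even 2∣z = g , eq , minus-pos₂ y 2 (2 * g) eq
    next-gap {y} {z} y<z sy≢z | inj₁ 2∣y | inj₂ 2∣1+z with even-gap 2∣y 2∣1+z (<-trans y<z (n<1+n z))
    ...   | g , eq rewrite even?-even 2∣y | even?-odd (suc-even⇒odd 2∣1+z) =
      g , eq , minus-pos₂ y 1 (2 * g) (suc-injective eq)
    -- The one case in which `y` and `z` could form a full pair. Rewriting first turns `s y` into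
    -- `suc y`, so that `sy≢z` gives `suc y < z`.
    next-gap {y} {z} y<z sy≢z | inj₂ 2∣1+y | inj₁ 2∣z
      rewrite even?-odd (suc-even⇒odd 2∣1+y) | even?-even 2∣z with even-gap 2∣1+y 2∣z (≤∧≢⇒< y<z sy≢z)
    ...   | g , eq = g , eq , minus-pos₂ y 3 (2 * g) eq
    next-gap {y} {z} y<z sy≢z | inj₂ 2∣1+y | inj₂ 2∣1+z with even-gap 2∣1+y 2∣1+z (s≤s y<z)
    ...   | g , eq rewrite even?-odd (suc-even⇒odd 2∣1+y) | even?-odd (suc-even⇒odd 2∣1+z) =
      g , eq , minus-pos₂ y 2 (2 * g) (suc-injective eq)

    gap≡ : ∀ {i} j → i ≤ k → j < p i →
           ∃[ g ] ceil (x i (suc j)) ≡ 2 + ceil (x̂ i j) + 2 * g × gap i j ≡ + (2 * g)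
    gap≡ {i} zero    i≤k j<p = first-gap (x̂₀-even i i≤k) (x̂₀-< i i≤k j<p)
    gap≡ {i} (suc j) i≤k j<p rewrite x̂-suc i j = next-gap (x-< i≤k j<p) (s[x]≢x i≤k j<p)

    -- The minima

    excess : ℕ
    excess = (l ∸ t⁽ k ⁾) / 2

    l≡ : l ≡ t⁽ k ⁾ + 2 * excess
    l≡ = trans (sym (m+[n∸m]≡n (≤-trans t≤l⊓ (m⊓n≤m l _)))) (cong (λ e → t⁽ k ⁾ + e) (sym (m*[n/m]≡n l-t-even)))

    M : ℕ → ℕ
    M i = foldr _⊓_ excess (applyUpTo (λ d → slack/2 (i + d)) (k ∸ i))

    M-suc : ∀ {i} → i < k → M i ≡ slack/2 i ⊓ M (suc i)
    M-suc {i} i<k rewrite +-∸-assoc 1 i<k | +-identityʳ i =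
      cong (λ ms → slack/2 i ⊓ foldr _⊓_ excess ms) (applyUpTo-cong (k ∸ suc i) (λ d → cong slack/2 (+-suc i d)))

    M-last : M k ≡ excess
    M-last rewrite n∸n≡0 k = refl

    -- σ i is half the number of entries inserted before block i.
    σ : ℕ → ℕ
    σ zero    = 0
    σ (suc i) = M i

    σ≤M : ∀ {i} → i ≤ k → σ i ≤ M i
    σ≤M {zero}  _   = z≤n
    σ≤M {suc i} i<k = ≤-trans (≤-reflexive (M-suc i<k)) (m⊓n≤n (slack/2 i) _)

    inserted : ℕ → ℕ
    inserted i = M i ∸ σ i

    -- All terms are even and shifted by the same amount, so halving and shifting commute with the
    -- minimum.
    minSlack≡ : ∀ {i} → i ≤ k → minSlack l i (+ (2 * σ i)) ≡ + (2 * inserted i)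
    minSlack≡ {i} i≤k = trans (cong (foldr ℤ._⊓_ (+ l ℤ.- + t⁽ k ⁾ ℤ.- + (2 * σ i))) (map-applyUpTo (λ d → d) _ (k ∸ i)))
      (trans (foldr-⊓-double (k ∸ i) {g = λ d → slack/2 (i + d)} {c = excess} {s = + (2 * σ i)}
        (cong (λ z → z ℤ.- + (2 * σ i)) (trans (cong (λ l → + l ℤ.- + t⁽ k ⁾) l≡) (minus-pos t⁽ k ⁾ (2 * excess))))
        (λ d< → cong (λ z → z ℤ.- + (2 * σ i)) (slack≡ (≤-trans (+-monoʳ-< i d<) (≤-reflexive (m+[n∸m]≡n i≤k))))))
      (minus-pos-≤ (σ≤M i≤k)))

    ℓ-inside : ∀ {i j} → j < p i → ℓ l i j ≡ gap i j ℤ.⊓ R l i j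
    ℓ-inside {i} {j} j<p rewrite dec-true (j <? p i) j<p = refl

    ℓ-last : ∀ i → ℓ l i (p i) ≡ R l i (p i)
    ℓ-last i rewrite dec-false (p i <? p i) (<-irrefl refl) = refl

    -- The last number of a block is the whole remainder `R`, so the block uses up exactly its
    -- share.
    ∑ℓ≡l̃ : ∀ i → ∑ℓ l i (suc (p i)) ≡ l̃₊₁ l i
    ∑ℓ≡l̃ i = trans (cong (λ z → ∑ℓ l i (p i) ℤ.+ z) (ℓ-last i)) (cancel (∑ℓ l i (p i)) (l̃₊₁ l i))
      where
      cancel : ∀ a b → a ℤ.+ (b ℤ.- a) ≡ b
      cancel a b = trans (cong (λ z → a ℤ.+ z) (ℤ.+-comm b (ℤ.- a)))
        (trans (sym (ℤ.+-assoc a (ℤ.- a) b)) (trans (cong (ℤ._+ b) (ℤ.+-inverseʳ a)) (ℤ.+-identityˡ b)))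

    -- The sums telescope, since `σ i + inserted i` is `M i`, that is `σ (suc i)`.
    S≡ : ∀ i → i ≤ k → S l i ≡ + (2 * σ i)
    l̃≡ : ∀ i → i ≤ k → l̃₊₁ l i ≡ + (2 * inserted i)
    S≡ zero    _   = refl
    S≡ (suc i) i<k = trans (cong₂ ℤ._+_ (S≡ i (<⇒≤ i<k)) (trans (∑ℓ≡l̃ i) (l̃≡ i (<⇒≤ i<k))))
      (cong +_ (trans (sym (*-distribˡ-+ 2 (σ i) (inserted i))) (cong (2 *_) (m+[n∸m]≡n (σ≤M (<⇒≤ i<k))))))
    l̃≡ i i≤k = trans (cong (minSlack l i) (S≡ i i≤k)) (minSlack≡ i≤k)

    -- Blocks

    Tseg≡ : ∀ i j → i ≤ k → Tseg l i j ≡ interval (suc (ceil (x̂ i j))) ℤ.∣ ℓ l i j ∣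
    Tseg≡ i zero    i≤k rewrite ceil-even (x̂₀-even i i≤k) = cong (λ c → interval c ℤ.∣ ℓ l i 0 ∣) (+-comm (x̂ i 0) 1)
    Tseg≡ i (suc j) i≤k rewrite x̂-suc i j = cong (λ c → interval c ℤ.∣ ℓ l i (suc j) ∣) (after (x i (suc j)))
      where
      after : ∀ y → y + (if even? y then 1 else 2) ≡ suc (ceil y)
      after y with even? y
      ... | true  = +-comm y 1
      ... | false = +-comm y 2

    -- T^{(i)}_0 (x^{(i)}_1) ⋯ T^{(i)}_{j-1} (x^{(i)}_j)
    Tinit : ℕ → ℕ → List ℕ
    Tinit i zero    = []
    Tinit i (suc j) = Tblock l i j ++ x i (suc j) ∷ []

    Tblock≡ : ∀ i j → Tblock l i j ≡ Tinit i j ++ Tseg l i j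
    Tblock≡ i zero    = refl
    Tblock≡ i (suc j) = sym (++-assoc (Tblock l i j) (x i (suc j) ∷ []) (Tseg l i (suc j)))

    -- The block read from offset `x̂ i 0` up to the pair of `x̂ i j`, with the segment after it
    -- still open; `rest` is half of what remains to be inserted.
    record Init (i j : ℕ) : Set where
      field
        word    : Word
        sparse  : Sparse word
        size≡   : size word ≡ j
        end     : x̂ i 0 + 2 * length word ≡ ceil (x̂ i j)
        plain   : column (x̂ i 0) word ≡ applyUpTo (λ j → x i (suc j)) j
        filled  : column (x̂ i 0) (fill (inserted i) word) ≡ Tinit i j
        partial : ∑ℓ l i j ≡ + (2 * (inserted i ⊓ free word))
        ℓ-even  : ∀ {j′} → j′ < j → EvenNat (ℓ l i j′)

      rest : ℕ
      rest = inserted i ∸ free word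

      R≡ : i ≤ k → R l i j ≡ + (2 * rest)
      R≡ i≤k = trans (cong₂ ℤ._-_ (l̃≡ i i≤k) partial)
        (trans (minus-pos-≤ (m⊓n≤m (inserted i) (free word))) (cong (λ m → + (2 * m)) (∸-⊓ (inserted i) (free word))))
        where
        ∸-⊓ : ∀ m n → m ∸ (m ⊓ n) ≡ m ∸ n
        ∸-⊓ m n = trans (∸-distribˡ-⊓-⊔ m m n) (cong (λ z → z ⊔ (m ∸ n)) (n∸n≡0 m))

      column-word++ : ∀ v → column (x̂ i 0) (word ++ v) ≡ applyUpTo (λ j → x i (suc j)) j ++ column (ceil (x̂ i j)) v
      column-word++ v = trans (column-++ (x̂ i 0) word v) (cong₂ _++_ plain (cong (λ e → column e v) end))

      column-fill++ : ∀ v → column (x̂ i 0) (fill (inserted i) (word ++ v)) ≡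
                            Tinit i j ++ column (ceil (x̂ i j)) (fill rest v)
      column-fill++ v = trans (cong (column (x̂ i 0)) (fill-++ (inserted i) word v))
        (trans (column-++ (x̂ i 0) (fill (inserted i) word) (fill rest v))
          (cong₂ _++_ filled (cong (λ e → column e (fill rest v))
            (trans (cong (λ m → x̂ i 0 + 2 * m) (length-fill (inserted i) word)) end))))

    -- Passing to the next entry appends `g` empty pairs and one pair holding that entry. Greedy
    -- filling then fills `rest ⊓ g` of the new empty pairs, which is half of `gap i j ⊓ R i j`.
    init : ∀ i j → i ≤ k → j ≤ p i → Init i j
    init i zero    i≤k _   = record
      { word = [] ; sparse = [] ; size≡ = refl
      ; end = trans (+-identityʳ _) (sym (ceil-even (x̂₀-even i i≤k)))
      ; plain = refl
      ; filled = cong (column (x̂ i 0)) (fill-[] (inserted i))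
      ; partial = sym (cong (λ m → + (2 * m)) (⊓-zeroʳ (inserted i)))
      ; ℓ-even = λ ()
      }
      where
      fill-[] : ∀ m → fill m [] ≡ []
      fill-[] zero    = refl
      fill-[] (suc m) = refl
    init i (suc j) i≤k j<p with init i j i≤k (<⇒≤ j<p) | gap≡ j i≤k j<p
    ... | I | g , ceil≡ , gap≡2g = record
      { word    = word ++ extension
      ; sparse  = All.++⁺ sparse (All.++⁺ (sparse-none g) (entry≢both y ∷ []))
      ; size≡   = trans (size-++ word extension) (trans (cong₂ _+_ size≡ size-extension) (+-comm j 1))
      ; end     = trans (cong (λ m → x̂ i 0 + 2 * m) (trans (length-++ word) (cong (λ m → length word + m) length-extension)))
                    (trans (shift (x̂ i 0) (length word) g) (trans (cong (λ e → 2 + e + 2 * g) end) (trans (sym ceil≡) (cong ceil (sym (x̂-suc i j))))))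
      ; plain   = trans (column-word++ extension)
                    (trans (cong (λ ys → applyUpTo (λ j → x i (suc j)) j ++ ys)
                      (trans (column-++ e (replicate g none) (entry y ∷ [])) (cong₂ _++_ (column-none e g) column-y)))
                    (applyUpTo-∷ʳ (λ j → x i (suc j)) j))
      ; filled  = trans (column-fill++ extension) (trans (cong (Tinit i j ++_) column-extension)
                    (trans (sym (++-assoc (Tinit i j) (Tseg l i j) (y ∷ []))) (cong (_++ y ∷ []) (sym (Tblock≡ i j)))))
      ; partial = trans (cong₂ ℤ._+_ partial ℓ≡) (cong +_ (trans (sym (*-distribˡ-+ 2 (inserted i ⊓ free word) (rest ⊓ g)))
                    (cong (2 *_) (trans (⊓-+ (inserted i) (free word) g) (cong (inserted i ⊓_) (sym free≡))))))
      ; ℓ-even  = λ j′<1+j → ℓ-even′ (m<1+n⇒m<n∨m≡n j′<1+j)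
      }
      where
      open Init I
      y = x i (suc j)
      e = ceil (x̂ i j)
      extension = replicate g none ++ entry y ∷ []
      shift : ∀ o m g → o + 2 * (m + suc g) ≡ 2 + (o + 2 * m) + 2 * g
      shift = solve-∀
      length-extension : length extension ≡ suc g
      length-extension = trans (length-++ (replicate g none)) (trans (cong (_+ 1) (length-replicate g)) (+-comm g 1))
      size-extension : size extension ≡ 1
      size-extension = trans (size-++ (replicate g none) _) (cong₂ _+_ (size-none g) (size-entry y))
      free≡ : free (word ++ extension) ≡ free word + g
      free≡ = trans (free-++ word extension) (cong (λ m → free word + m)
        (trans (free-++ (replicate g none) _) (trans (cong₂ _+_ (free-none g) (free-entry y)) (+-identityʳ g))))
      at-y : e + 2 * length (replicate g none) ≡ e + 2 * g
      at-y = cong (λ m → e + 2 * m) (length-replicate g)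
      column-y : column (e + 2 * length (replicate g none)) (entry y ∷ []) ≡ y ∷ []
      column-y = column-entry y (trans ceil≡ (cong (λ o → 2 + o) (sym at-y)))
      ℓ≡ : ℓ l i j ≡ + (2 * (rest ⊓ g))
      ℓ≡ = trans (ℓ-inside j<p) (trans (cong₂ ℤ._⊓_ gap≡2g (R≡ i≤k))
             (cong +_ (trans (sym (*-distribˡ-⊓ 2 g rest)) (cong (2 *_) (⊓-comm g rest)))))
      column-extension : column e (fill rest extension) ≡ Tseg l i j ++ y ∷ []
      -- Filling may continue past the `g` empty pairs, but the pair of `y` is not empty and stays
      -- as it is.
      column-extension = trans (cong (column e) (fill-++ rest (replicate g none) _))
        (trans (column-++ e (fill rest (replicate g none)) _) (cong₂ _++_
          (trans (column-fill-none e rest g) (trans (cong (λ z → interval (suc e) ℤ.∣ z ∣) (sym ℓ≡)) (sym (Tseg≡ i j i≤k))))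
          (trans (cong₂ column (cong (λ m → e + 2 * m) (length-fill rest (replicate g none))) (fill-entry (rest ∸ free (replicate g none)) (entry≢none y))) column-y)))
      ℓ-even′ : ∀ {j′} → j′ < j ⊎ j′ ≡ j → EvenNat (ℓ l i j′)
      ℓ-even′ (inj₁ j′<j) = ℓ-even j′<j
      ℓ-even′ (inj₂ refl) = rest ⊓ g , ℓ≡

    -- A whole block, extended to the bound `c`, which is one less than `α (suc i)` or is `2 * n`.
    -- The last `ℓ` is not capped by a gap, so `filled` depends on the block having enough empty
    -- pairs.
    record Block (i c : ℕ) : Set where
      field
        word   : Word
        sparse : Sparse word
        size≡  : size word ≡ p i
        end    : x̂ i 0 + 2 * length word ≡ c
        plain  : column (x̂ i 0) word ≡ X i
        filled : inserted i ≤ free word → column (x̂ i 0) (fill (inserted i) word) ≡ Tblock l i (p i)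
        ℓ-even : ∀ {j} → j ≤ p i → EvenNat (ℓ l i j)

    block : ∀ {i c} → i ≤ k → 2 ∣ c → x̂ i (p i) ≤ c → Block i c
    block {i} {c} i≤k 2∣c x≤c with init i (p i) i≤k ≤-refl | even-diff (2∣ceil (x̂ i (p i))) 2∣c (ceil-≤ 2∣c x≤c)
    ... | I | g , c≡ = record
      { word   = word ++ replicate g none
      ; sparse = All.++⁺ sparse (sparse-none g)
      ; size≡  = trans (size-++ word _) (trans (cong₂ _+_ size≡ (size-none g)) (+-identityʳ (p i)))
      ; end    = trans (cong (λ m → x̂ i 0 + 2 * m) (trans (length-++ word) (cong (λ m → length word + m) (length-replicate g))))
                   (trans (shift (x̂ i 0) (length word) g) (trans (cong (_+ 2 * g) end) (sym c≡)))
      ; plain  = trans (column-word++ _) (trans (cong (X i ++_) (column-none e g)) (++-identityʳ (X i)))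
      ; filled = λ fits → trans (column-fill++ (replicate g none)) (trans
          (cong (Tinit i (p i) ++_) (trans (column-fill-none e rest g)
            (trans (cong (λ m → interval (suc e) (2 * m)) (m≤n⇒m⊓n≡m (rest≤g fits)))
              (trans (cong (λ z → interval (suc e) ℤ.∣ z ∣) (sym ℓ≡)) (sym (Tseg≡ i (p i) i≤k))))))
          (sym (Tblock≡ i (p i))))
      ; ℓ-even = λ j≤p → ℓ-even′ (m≤n⇒m<n∨m≡n j≤p)
      }
      where
      open Init I
      e = ceil (x̂ i (p i))
      shift : ∀ o m g → o + 2 * (m + g) ≡ o + 2 * m + 2 * g
      shift = solve-∀
      ℓ≡ : ℓ l i (p i) ≡ + (2 * rest)
      ℓ≡ = trans (ℓ-last i) (R≡ i≤k)
      rest≤g : inserted i ≤ free (word ++ replicate g none) → rest ≤ g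
      rest≤g fits = m≤n+o⇒m∸n≤o (inserted i) (free word)
        (≤-trans fits (≤-reflexive (trans (free-++ word _) (cong (λ m → free word + m) (free-none g)))))
      ℓ-even′ : ∀ {j} → j < p i ⊎ j ≡ p i → EvenNat (ℓ l i j)
      ℓ-even′ (inj₁ j<p) = ℓ-even j<p
      ℓ-even′ (inj₂ refl) = rest , ℓ≡

    -- Assembly

    -- The stage ends with pair c; f is the number of empty pairs of T unmatched by then.
    record Stage (i c f : ℕ) : Set where
      field
        aword   : Word
        Tword   : Word
        a≡      : column 0 aword ≡ a-upTo i
        T≡      : column 0 Tword ≡ T-upTo l i
        length≡ : length Tword ≡ length aword
        end     : length aword ≡ c
        size≡   : size Tword ≡ t⁽ i ⁾ + 2 * M i
        reduce≡ : ∀ v → reduce 0 (Tword ++ v) ≡ aword ++ reduce f v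
        ℓ-even  : ∀ {j} → j ≤ p i → EvenNat (ℓ l i j)

    -- The last equation counts the `c` pairs of `T` read so far: `t⁽ i ⁾` hold an entry of some
    -- `X`, belong to some `A` or are matched with a pair of some `A`; `M i` are filled; `f` are
    -- empty and unmatched.
    stage : ∀ i {c f} → i ≤ k → x̂ i (p i) ≤ 2 * c → c ≡ t⁽ i ⁾ + M i + f → Stage i c f
    stage zero {c} {f} i≤k x≤2c c≡ = record
      { aword   = word
      ; Tword   = fill (M 0) word
      ; a≡      = plain
      ; T≡      = filled (balanced⇒fits {0} (inj₁ refl) balance)
      ; length≡ = length-fill (M 0) word
      ; end     = length≡c
      ; size≡   = trans (size-fill {M 0} word (balanced⇒fits {0} (inj₁ refl) balance)) (cong (_+ 2 * M 0) size≡)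
      ; reduce≡ = λ v → reduce-fill v sparse (inj₁ refl) balance
      ; ℓ-even  = ℓ-even
      }
      where
      open Block (block {0} {2 * c} i≤k (m∣m*n c) x≤2c)
      length≡c : length word ≡ c
      length≡c = *-cancelˡ-≡ _ _ 2 end
      balance : free word ≡ M 0 + f
      balance = +-cancelˡ-≡ (p 0) _ _ (trans (+-comm (p 0) (free word)) (trans (cong (λ m → free word + m) (sym size≡))
        (trans (sym (sparse-length sparse)) (trans length≡c (trans c≡ (+-assoc (p 0) (M 0) f))))))
    stage (suc i) {c} {f} i<k x≤2c c≡ = record
      { aword   = St.aword ++ full ++ word
      ; Tword   = St.Tword ++ full ++ fill m word
      ; a≡      = trans (column-join St.aword word St.end) (cong₂ _++_ St.a≡ (cong (A (suc i) ++_) plain))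
      ; T≡      = trans (column-join St.Tword (fill m word) (trans St.length≡ St.end))
                    (cong₂ _++_ St.T≡ (cong (A (suc i) ++_) (filled fits)))
      ; length≡ = trans (length-join St.Tword (fill m word))
                    (trans (cong₂ (λ a b → a + (q + b)) St.length≡ (length-fill m word)) (sym (length-join St.aword word)))
      ; end     = trans (length-join St.aword word) (trans (cong (_+ (q + length word)) St.end) length≡c)
      ; size≡   = trans (size-++ St.Tword _) (trans (cong₂ _+_ St.size≡ (trans (size-++ full _)
                    (cong₂ _+_ (size-both q) (trans (size-fill word fits) (cong (_+ 2 * m) size≡)))))
                    (trans (size-shift t⁽ i ⁾ (M i) (2 * q) (p (suc i)) m) (cong₂ (λ t M → t⁽ i ⁾ + t + p (suc i) + 2 * M)
                      (sym (t≡2τ i<k)) (m+[n∸m]≡n M≤M))))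
      ; reduce≡ = λ v → trans (cong (reduce 0) (trans (++-assoc St.Tword _ v) (cong (St.Tword ++_) (++-assoc full _ v))))
                    (trans (St.reduce≡ _) (trans (cong (St.aword ++_) (trans (reduce-both q _) (cong (full ++_) (reduce-fill v sparse saturated balance))))
                      (sym (trans (++-assoc St.aword _ _) (cong (St.aword ++_) (++-assoc full word _))))))
      ; ℓ-even  = ℓ-even
      }
      where
      q = τ (suc i)
      b = slack/2 i
      full = replicate q both
      c₀ = t⁽ i ⁾ + q + b
      m = inserted (suc i)
      d = b ∸ M i
      M≤b : M i ≤ b
      M≤b = ≤-trans (≤-reflexive (M-suc i<k)) (m⊓n≤m b _)
      M≤M : M i ≤ M (suc i)
      M≤M = σ≤M i<k
      stage-shift : ∀ T q M d → T + q + (M + d) ≡ T + M + (q + d)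
      stage-shift = solve-∀
      -- Of the `q + d` empty pairs unmatched before `A (suc i)`, its full pairs match `q` and leave
      -- `d`.
      module St = Stage (stage i {c₀} {q + d} (<⇒≤ i<k)
        (≤-pred (≤-trans (x̂-last-< i<k) (≤-reflexive (α≡ i<k))))
        (trans (cong (λ b → t⁽ i ⁾ + q + b) (sym (m+[n∸m]≡n M≤b))) (stage-shift t⁽ i ⁾ q (M i) d)))
      open Block (block {suc i} {2 * c} i<k (m∣m*n c) x≤2c)
      saturated : d ≡ 0 ⊎ m ≡ 0
      -- `M i` is the smaller of `b` and `M (suc i)`: in the first case no unmatched empty pair is
      -- left, in the second nothing is filled in this block.
      saturated with ⊓-sel b (M (suc i))
      ... | inj₁ eq = inj₁ (trans (cong (b ∸_) (trans (M-suc i<k) eq)) (n∸n≡0 b))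
      ... | inj₂ eq = inj₂ (trans (cong (M (suc i) ∸_) (trans (M-suc i<k) eq)) (n∸n≡0 (M (suc i))))
      length≡c : c₀ + (q + length word) ≡ c
      length≡c = *-cancelˡ-≡ _ _ 2 (trans (double-shift c₀ q (length word)) (trans (cong (_+ 2 * length word) (sym (x̂₀≡ i<k))) end))
        where
        double-shift : ∀ c q w → 2 * (c + (q + w)) ≡ 2 * c + 2 * q + 2 * w
        double-shift = solve-∀
      balance : d + free word ≡ m + f
      -- After adding the cancelled term, both sides equal the number `c` of pairs.
      balance = +-cancelˡ-≡ (M i + (t⁽ i ⁾ + 2 * q + p (suc i))) _ _
        (trans (left t⁽ i ⁾ q (M i) d (p (suc i)) (free word))
        (trans (cong₂ (λ b w → t⁽ i ⁾ + q + b + (q + w)) (m+[n∸m]≡n M≤b)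
          (trans (cong (λ s → free word + s) (sym size≡)) (sym (sparse-length sparse))))
        (trans length≡c (trans c≡ (trans
          (cong₂ (λ t M → t⁽ i ⁾ + t + p (suc i) + M + f) (t≡2τ i<k) (sym (m+[n∸m]≡n M≤M)))
          (right (t⁽ i ⁾ + 2 * q + p (suc i)) (M i) m f))))))
        where
        left : ∀ T q M d p w → M + (T + 2 * q + p) + (d + w) ≡ T + q + (M + d) + (q + (w + p))
        left = solve-∀
        right : ∀ T M m f → T + (M + m) + f ≡ M + T + (m + f)
        right = solve-∀
      fits : m ≤ free word
      fits = balanced⇒fits saturated balance
      size-shift : ∀ T M t p m → T + 2 * M + (t + (p + 2 * m)) ≡ T + t + p + 2 * (M + m)
      size-shift = solve-∀
      length-join : ∀ u w → length (u ++ full ++ w) ≡ length u + (q + length w)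
      length-join u w = trans (length-++ u) (cong (λ m → length u + m)
        (trans (length-++ full) (cong (_+ length w) (length-replicate q))))
      column-join : ∀ u w → length u ≡ c₀ → column 0 (u ++ full ++ w) ≡ column 0 u ++ A (suc i) ++ column (x̂ (suc i) 0) w
      column-join u w len = trans (column-++ 0 u (full ++ w)) (cong (column 0 u ++_)
        (trans (cong (λ c → column (2 * c) (full ++ w)) len) (trans (column-++ (2 * c₀) full w) (cong₂ _++_
          (trans (column-both (2 * c₀) q) (cong₂ interval (sym (α≡ i<k)) (sym (t≡2τ i<k))))
          (cong (λ e → column e w) (trans (cong (λ m → 2 * c₀ + 2 * m) (length-replicate q)) (sym (x̂₀≡ i<k))))))))

    final : Stage k n (n ∸ (t⁽ k ⁾ + excess))
    final = stage k ≤-refl x̂-last-≤ (trans (sym (m+[n∸m]≡n room)) (cong (λ m → t⁽ k ⁾ + m + (n ∸ (t⁽ k ⁾ + excess))) (sym M-last)))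
      where
      double : ∀ T e → 2 * (T + e) ≡ T + (T + 2 * e)
      double = solve-∀
      t≤2n-l : t⁽ k ⁾ ≤ 2 * n ∸ l
      t≤2n-l = ≤-trans t≤l⊓ (m⊓n≤n l _)
      -- Twice the left side is `t⁽ k ⁾ + l`, at most `2 * n` because `t⁽ k ⁾ ≤ 2 * n ∸ l`. Hence
      -- the leftover `n ∸ (t⁽ k ⁾ + excess)` is exact.
      room : t⁽ k ⁾ + excess ≤ n
      room = *-cancelˡ-≤ 2 (≤-trans (≤-reflexive (trans (double t⁽ k ⁾ excess) (cong (λ m → t⁽ k ⁾ + m) (sym l≡))))
               (≤-trans (+-monoˡ-≤ l t≤2n-l) (≤-reflexive (m∸n+n≡m l≤2n))))

    -- Evenness, membership, reduction and uniqueness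

    all-even : ∀ i → i ≤ k → (0ℤ ℤ.≤ l̃₊₁ l i × + 2 ℤ.∣ l̃₊₁ l i) ×
                             (∀ j → j ≤ p i → 0ℤ ℤ.≤ ℓ l i j × + 2 ℤ.∣ ℓ l i j)
    all-even i i≤k = even-nonneg (inserted i , l̃≡ i i≤k) , λ j j≤p → even-nonneg (ev (m≤n⇒m<n∨m≡n i≤k) j≤p)
      where
      ev : i < k ⊎ i ≡ k → ∀ {j} → j ≤ p i → EvenNat (ℓ l i j)
      ev (inj₁ i<k) = Block.ℓ-even (block i≤k (m∣m*n (t⁽ i ⁾ + τ (suc i) + slack/2 i)) (≤-pred (≤-trans (x̂-last-< i<k) (≤-reflexive (α≡ i<k)))))
      ev (inj₂ refl) = Stage.ℓ-even final

    module Final = Stage final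

    T-size : size Final.Tword ≡ l
    T-size = trans Final.size≡ (trans (cong (λ m → t⁽ k ⁾ + 2 * m) M-last) (sym l≡))

    reduce-T : reduce 0 Final.Tword ≡ Final.aword
    reduce-T = trans (cong (reduce 0) (sym (++-identityʳ _))) (trans (Final.reduce≡ []) (++-identityʳ _))

    T-SST : IsSST n l (T l)
    T-SST = subst (IsSST n l) Final.T≡ (record
      { length≡    = trans (length-column 0 Final.Tword) T-size
      ; increasing = Linked.tail (column-increasing 0 Final.Tword)
      ; entries    = All.zip (column-> 0 Final.Tword ,
          All.map (λ y≤ → ≤-trans y≤ (≤-reflexive (cong (2 *_) (trans Final.length≡ Final.end)))) (column-≤ 0 Final.Tword))
      })

    red-T : red (T l) ≡ a
    red-T = trans (cong red (sym Final.T≡)) (trans (red-column Final.Tword) (trans (cong (column 0) reduce-T) Final.a≡))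

    -- The reductions agree as columns and, both having `n` pairs, as words. Since both columns have
    -- `l` entries, `reduce-injective` applies.
    T-unique : ∀ b → IsSST n l b → red b ≡ a → b ≡ T l
    T-unique b b-SST red≡a with column-surjective n 0 b
        (Linked-positive (All.map proj₁ (IsSST.entries b-SST)) (IsSST.increasing b-SST)) (All.map proj₂ (IsSST.entries b-SST))
    ... | w , length≡n , refl = trans (cong (column 0) (reduce-injective w Final.Tword
      (trans (sym (length-column 0 w)) (trans (IsSST.length≡ b-SST) (sym T-size)))
      (trans (column-injective 0 _ _ (trans (length-reduce 0 w) (trans length≡n (sym Final.end)))
        (trans (sym (red-column w)) (trans red≡a (sym Final.a≡)))) (sym reduce-T)))) Final.T≡

theorem7 :
  ∀ (n l k : ℕ) (t p α : ℕ → ℕ) (x : ℕ → ℕ → ℕ) →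
  let open Construction k t p α x in
  1 ≤ n →
  l ≤ 2 * n →
  (∀ i → 1 ≤ i → i ≤ k → 1 ≤ t i × 2 ∣ t i) →
  1 ≤ t⁽ k ⁾ →
  t⁽ k ⁾ ≤ n →
  t⁽ k ⁾ ≤ l ⊓ (2 * n ∸ l) →
  2 ∣ l ∸ t⁽ k ⁾ →
  IsSpT n t⁽ k ⁾ a →
  (∀ i → i ≤ k → ∀ y → y ∈ X i → s y ∉ a) →
  (∀ i → 1 ≤ i → i ≤ k → ¬ 2 ∣ α i) →
  (∀ i → 1 ≤ i → i ≤ k → MaximalStableInterval a (α i) (t i)) →
  (∀ c m → MaximalStableInterval a c m → ∃[ i ] 1 ≤ i × i ≤ k × c ≡ α i × m ≡ t i) →
  (∀ i → i < k → 2 * t⁽ i ⁾ + t (suc i) + 1 ≤ α (suc i)) →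
  (∀ i → i ≤ k →
    (0ℤ ℤ.≤ l̃₊₁ l i × + 2 ℤ.∣ l̃₊₁ l i) ×
    (∀ j → j ≤ p i → 0ℤ ℤ.≤ ℓ l i j × + 2 ℤ.∣ ℓ l i j)) ×
  IsSST n l (T l) ×
  red (T l) ≡ a ×
  (∀ b → IsSST n l b → red b ≡ a → b ≡ T l)
theorem7 n l k t p α x _ l≤2n t-even _ _ t≤l⊓ l-t-even a-SpT s[X]∉a α-odd _ _ α-large =
  all-even , T-SST , red-T , T-unique
  where
  open Preimage n l k t p α x
  open Properties t-even l≤2n t≤l⊓ l-t-even a-SpT s[X]∉a α-odd α-large
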